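{- Let $T$ be a real symmetric tensor of order 3 and size $n$. For any integer $r$, $\operatorname{srank}(T)\le r$ if and only if there is a real symmetric tensor $S$ of order 3 and size $r+n$ such that: (i) The slices of $S$ pairwise commute. (ii) $T$ is a subtensor of $S$ in the sense that $T_{ijk}=S_{ijk}$ for all $1\le i,j,k\le n$. (iii) Any matrix in the subspace spanned by the slices of $S$ is of rank at most $r$.
   Context: A tensor of order 3 and size $n$ over $K$ is an array $T\in K^{n\times n\times n}$; it is symmetric if $T_{ijk}$ is invariant under all permutations of $i,j,k$. The $k$-th slice of a symmetric tensor $T$ of size $n$ is the symmetric $n\times n$ matrix $(T_{ijk})_{i,j}$, for $1\le k\le n$. For $u\in K^n$, $u^{\otimes 3}=u\otimes u\otimes u$ is the tensor with entries $u_iu_ju_k$. The symmetric rank $\operatorname{srank}(T)$ over $K$ (here $K=\mathbb{R}$) is the smallest $r$ such that $T=\sum_{i=1}^r u_i^{\otimes 3}$ with $u_i\in K^n$. The span of slices is taken over $\mathbb{R}$. -}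

module Defs where

open import Algebra.Bundles using (CommutativeRing)
open import Data.Fin.Base using (Fin; _↑ˡ_)
open import Data.Fin.Patterns using (0F; 1F; 2F)
open import Data.Fin.Permutation using (Permutation′; _⟨$⟩ʳ_)
open import Data.Nat.Base as ℕ using (ℕ)
open import Data.Product.Base using (∃; ∃-syntax; Σ-syntax; _×_; uncurry)
open import Data.Vec.Functional using (Vector)
open import Level using (0ℓ; suc)
open import Relation.Binary.Core using (Rel)
open import Relation.Binary.Structures using (IsTotalOrder)
open import Relation.Nullary.Negation.Core using (¬_)

-- The real numbers, axiomatised as a Dedekind-complete ordered field.
-- Classically this determines ℝ up to a unique isomorphism.
record CompleteOrderedField : Set (suc 0ℓ) where
  infix 4 _≤_
  field
    commutativeRing : CommutativeRing 0ℓ 0ℓ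

  open CommutativeRing commutativeRing public

  field
    0≉1          : ¬ (0# ≈ 1#)
    inverse      : ∀ x → ¬ (x ≈ 0#) → ∃[ y ] (x * y ≈ 1#)
    _≤_          : Rel Carrier 0ℓ
    isTotalOrder : IsTotalOrder _≈_ _≤_
    +-monoʳ-≤    : ∀ x {y z} → y ≤ z → (x + y) ≤ (x + z)
    *-nonNeg     : ∀ {x y} → 0# ≤ x → 0# ≤ y → 0# ≤ (x * y)

  UpperBound : (Carrier → Set) → Carrier → Set
  UpperBound P b = ∀ x → P x → x ≤ b

  -- P is not required to respect _≈_: a set and its closure under _≈_
  -- have the same upper bounds.
  field
    supremum : (P : Carrier → Set) → ∃ P → ∃ (UpperBound P) →
               ∃[ s ] (UpperBound P s × (∀ b → UpperBound P b → s ≤ b))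

module Tensors (ℝ : CompleteOrderedField) where

  open CompleteOrderedField ℝ using (Carrier; _≈_; _*_; 0#; +-monoid)
  open import Algebra.Properties.Monoid.Sum +-monoid using (sum-syntax)

  Matrix : ℕ → Set
  Matrix n = Fin n → Fin n → Carrier

  -- Vectors are functions I → ℝ with an arbitrary index type I, so that
  -- I = Fin n × Fin n covers matrices.
  lincomb : ∀ {I : Set} {m} → Vector Carrier m → Vector (I → Carrier) m → I → Carrier
  lincomb {m = m} c v i = ∑[ k < m ] (c k * v k i)

  infix 4 _∈Span_
  _∈Span_ : ∀ {I : Set} {m} → (I → Carrier) → Vector (I → Carrier) m → Set
  w ∈Span v = ∃[ c ] (∀ i → w i ≈ lincomb c v i)

  LinearlyIndependent : ∀ {I : Set} {m} → Vector (I → Carrier) m → Set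
  LinearlyIndependent v =
    ∀ c → (∀ i → lincomb c v i ≈ 0#) → ∀ k → c k ≈ 0#

  column : ∀ {n} → Matrix n → Fin n → (Fin n → Carrier)
  column M j i = M i j

  -- The column space has a basis of k vectors.
  HasRank : ∀ {n} → Matrix n → ℕ → Set
  HasRank {n} M k =
    Σ[ b ∈ Vector (Fin n → Carrier) k ]
      (LinearlyIndependent b
      × (∀ l → b l ∈Span column M)
      × (∀ j → column M j ∈Span b))

  Rank≤ : ∀ {n} → Matrix n → ℕ → Set
  Rank≤ M r = ∃[ k ] (HasRank M k × k ℕ.≤ r)

  infixl 7 _·_
  _·_ : ∀ {n} → Matrix n → Matrix n → Matrix n
  _·_ {n} A B i j = ∑[ k < n ] (A i k * B k j)

  Commute : ∀ {n} → Matrix n → Matrix n → Set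
  Commute A B = ∀ i j → (A · B) i j ≈ (B · A) i j

  Tensor : ℕ → Set
  Tensor n = Fin n → Fin n → Fin n → Carrier

  IsSymmetric : ∀ {n} → Tensor n → Set
  IsSymmetric {n} T = ∀ (π : Permutation′ 3) (i : Vector (Fin n) 3) →
    T (i (π ⟨$⟩ʳ 0F)) (i (π ⟨$⟩ʳ 1F)) (i (π ⟨$⟩ʳ 2F)) ≈ T (i 0F) (i 1F) (i 2F)

  slice : ∀ {n} → Tensor n → Fin n → Matrix n
  slice T k i j = T i j k

  _∈SliceSpan_ : ∀ {n} → Matrix n → Tensor n → Set
  M ∈SliceSpan S = uncurry M ∈Span λ k → uncurry (slice S k)

  cube : ∀ {n} → (Fin n → Carrier) → Tensor n
  cube u i j k = u i * u j * u k

  SumOfCubes : ∀ {n} → Tensor n → ℕ → Set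
  SumOfCubes {n} T r =
    Σ[ u ∈ Vector (Fin n → Carrier) r ]
      (∀ i j k → T i j k ≈ ∑[ l < r ] cube (u l) i j k)

  HasSrank : ∀ {n} → Tensor n → ℕ → Set
  HasSrank T m = SumOfCubes T m × (∀ k → SumOfCubes T k → m ℕ.≤ k)

  Srank≤ : ∀ {n} → Tensor n → ℕ → Set
  Srank≤ T r = ∃[ m ] (HasSrank T m × m ℕ.≤ r)

  -- The index set of the larger tensor is Fin (n + r), whose first n
  -- elements are the images i ↑ˡ r.
  IsSubtensor : ∀ {n r} → Tensor n → Tensor (n ℕ.+ r) → Set
  IsSubtensor {n} {r} T S =
    ∀ i j k → T i j k ≈ S (i ↑ˡ r) (j ↑ˡ r) (k ↑ˡ r)

{-# OPTIONS --safe #-}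

-- A sum of cubes of pairwise orthogonal vectors has commuting slices, so
-- for ⇒ the vectors of a decomposition of T are extended by r coordinates
-- that make them orthogonal. For ⇐, commuting slices mean that contraction
-- with S is a commutative associative product x ∗ y with self-adjoint
-- multiplications. If x ∗_ is nonzero of minimal rank, every proper factor
-- (x ∗_) ∘ (y ∗_ - c) of it vanishes, so each y ∗_ acts on the image of x ∗_ as
-- a scalar, and an eigenvector w of x ∗_ is a common eigenvector of the
-- slices. Then a multiple of w ⊗ w ⊗ w splits off S, which lowers the rank of
-- the slice space by one. Eigenvalues of symmetric matrices come from the
-- supremum of the Rayleigh quotients.
module Submission where

-- The rank condition bounds each slice combination separately, while a decomposition counts common
-- eigenvectors. One explicit combination links the two: if the multiplication by `c` has rank `k`
-- after deflation, that by `raised c` has rank at least `k + 1` before it. The induction therefore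
-- runs on `r`, and the ambient space stays fixed. An element of minimal rank serves all slices at
-- once, so every map remains an endomorphism of the same `V n` instead of being restricted to
-- successive eigenspaces. Eigenvectors are left unnormalised, which is why `w ∙ w` and its inverse
-- run through the formulas. The only root extracted is the cube root of the coefficient of
-- `w ⊗ w ⊗ w`; it exists for either sign, and it makes the term a cube. In the other direction `r`
-- extra coordinates suffice because only the off-diagonal entries of the Gram matrix have to be
-- cancelled, and a triangular choice of the new coordinates does that.

open import Defs
open import Algebra.Bundles using (CommutativeRing)
open import Axiom.ExcludedMiddle using (ExcludedMiddle)
open import Data.Fin.Base using (Fin; zero; suc; punchIn; punchOut; _↑ˡ_; _↑ʳ_)
open import Data.Fin.Patterns using (0F; 1F; 2F)
open import Data.Fin.Permutation using (_⟨$⟩ʳ_; transpose)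
import Data.Fin.Properties as Fin
open import Data.Integer.Base as ℤ using (ℤ; +_; -[1+_])
import Data.Integer.Properties as ℤ
open import Data.Maybe.Base using (just; nothing)
open import Data.Nat.Base as ℕ using (ℕ; zero; suc)
open import Data.Nat.Induction using (<-rec)
import Data.Nat.Properties as ℕ
open import Data.Product.Base using (Σ-syntax; ∃; ∃-syntax; _×_; _,_; proj₁; proj₂)
open import Data.Sum.Base using (_⊎_; inj₁; inj₂; [_,_]′)
open import Data.Vec.Functional using (Vector; _∷_; []; _++_)
open import Data.Vec.Functional.Properties using (lookup-++ˡ; lookup-++ʳ)
open import Function.Base using (_∘_)
open import Function.Bundles using (_⇔_; mk⇔)
open import Level using (0ℓ)
open import Relation.Binary.Bundles using (TotalOrder)
open import Relation.Binary.Definitions using (WeaklyDecidable)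
open import Relation.Binary.PropositionalEquality.Core as ≡ using (_≢_)
open import Relation.Nullary using (¬_; Dec; yes; no; contradiction)

-- The ring solver over ℤ: with coefficients in an abstract ring, whose
-- equality does not compute, cancellation would not be recognised.
module IntegerCoefficientSolver (R : CommutativeRing 0ℓ 0ℓ) where
  open CommutativeRing R
  open import Algebra.Properties.Semiring.Mult.TCOptimised semiring
    renaming (_×_ to _·_)
  open import Algebra.Properties.Ring ring
  open import Algebra.Solver.Ring.AlmostCommutativeRing
    using (fromCommutativeRing; _-Raw-AlmostCommutative⟶_; Induced-equivalence)
  open import Relation.Binary.Reasoning.Setoid setoid

  ⟦_⟧ℤ : ℤ → Carrier
  ⟦ + n      ⟧ℤ = n · 1#
  ⟦ -[1+ n ] ⟧ℤ = - (suc n · 1#)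

  x+y-[x+z]≈y-z : ∀ x y z → (x + y) - (x + z) ≈ y - z
  x+y-[x+z]≈y-z x y z = begin
    (x + y) - (x + z)     ≈⟨ +-cong (+-comm x y) (sym (-‿+-comm x z)) ⟩
    (y + x) + (- x - z)   ≈⟨ +-assoc y x _ ⟩
    y + (x + (- x - z))   ≈⟨ +-congˡ (sym (+-assoc x _ _)) ⟩
    y + ((x - x) - z)     ≈⟨ +-congˡ (+-congʳ (-‿inverseʳ x)) ⟩
    y + (0# - z)          ≈⟨ +-congˡ (+-identityˡ _) ⟩
    y - z                 ∎

  ⊖-homo : ∀ m n → ⟦ m ℤ.⊖ n ⟧ℤ ≈ m · 1# - n · 1#
  ⊖-homo m       zero    = sym (trans (+-congˡ -0#≈0#) (+-identityʳ _))
  ⊖-homo zero    (suc n) = sym (+-identityˡ _)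
  ⊖-homo (suc m) (suc n) = begin
    ⟦ suc m ℤ.⊖ suc n ⟧ℤ             ≡⟨ ≡.cong ⟦_⟧ℤ (ℤ.[1+m]⊖[1+n]≡m⊖n m n) ⟩
    ⟦ m ℤ.⊖ n ⟧ℤ                     ≈⟨ ⊖-homo m n ⟩
    m · 1# - n · 1#                   ≈⟨ x+y-[x+z]≈y-z 1# _ _ ⟨
    (1# + m · 1#) - (1# + n · 1#)     ≈⟨ +-cong (1+× m 1#) (-‿cong (1+× n 1#)) ⟨
    suc m · 1# - suc n · 1#           ∎

  +-homo : ∀ i j → ⟦ i ℤ.+ j ⟧ℤ ≈ ⟦ i ⟧ℤ + ⟦ j ⟧ℤ
  +-homo (+ m)    (+ n)    = ×-homo-+ 1# m n
  +-homo (+ m)    -[1+ n ] = ⊖-homo m (suc n)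
  +-homo -[1+ m ] (+ n)    = trans (⊖-homo n (suc m)) (+-comm _ _)
  -- The sum computes to `-[1+ suc (m + n) ]`, with both successors in front; the rewriting moves
  -- one of them over to `n`.
  +-homo -[1+ m ] -[1+ n ] = begin
    - (suc (suc (m ℕ.+ n)) · 1#)        ≈⟨ -‿cong (1+× (suc m ℕ.+ n) 1#) ⟩
    - (1# + (suc m ℕ.+ n) · 1#)         ≈⟨ -‿cong (+-congˡ (×-homo-+ 1# (suc m) n)) ⟩
    - (1# + (suc m · 1# + n · 1#))      ≈⟨ -‿cong (sym (+-assoc _ _ _)) ⟩
    - (1# + suc m · 1# + n · 1#)        ≈⟨ -‿cong (+-congʳ (+-comm _ _)) ⟩
    - (suc m · 1# + 1# + n · 1#)        ≈⟨ -‿cong (+-assoc _ _ _) ⟩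
    - (suc m · 1# + (1# + n · 1#))      ≈⟨ -‿cong (+-congˡ (1+× n 1#)) ⟨
    - (suc m · 1# + suc n · 1#)         ≈⟨ -‿+-comm _ _ ⟨
    - (suc m · 1#) - suc n · 1#         ∎

  -‿homo : ∀ i → ⟦ ℤ.- i ⟧ℤ ≈ - ⟦ i ⟧ℤ
  -‿homo (+ zero)  = sym -0#≈0#
  -‿homo (+ suc n) = refl
  -‿homo -[1+ n ]  = sym (-‿involutive _)

  *-homo : ∀ i j → ⟦ i ℤ.* j ⟧ℤ ≈ ⟦ i ⟧ℤ * ⟦ j ⟧ℤ
  *-homo (+ m) (+ n) = trans (reflexive (≡.cong ⟦_⟧ℤ (≡.sym (ℤ.pos-* m n)))) (×1-homo-* m n)
  *-homo (+ m) -[1+ n ] = begin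
    ⟦ + m ℤ.* -[1+ n ] ⟧ℤ          ≡⟨ ≡.cong ⟦_⟧ℤ (ℤ.neg-distribʳ-* (+ m) (+ suc n)) ⟨
    ⟦ ℤ.- (+ m ℤ.* + suc n) ⟧ℤ     ≈⟨ -‿homo (+ m ℤ.* + suc n) ⟩
    - ⟦ + m ℤ.* + suc n ⟧ℤ         ≈⟨ -‿cong (*-homo (+ m) (+ suc n)) ⟩
    - (m · 1# * suc n · 1#)        ≈⟨ -‿distribʳ-* _ _ ⟩
    m · 1# * - (suc n · 1#)        ∎
  *-homo -[1+ m ] (+ n) = begin
    ⟦ -[1+ m ] ℤ.* + n ⟧ℤ          ≡⟨ ≡.cong ⟦_⟧ℤ (ℤ.neg-distribˡ-* (+ suc m) (+ n)) ⟨
    ⟦ ℤ.- (+ suc m ℤ.* + n) ⟧ℤ     ≈⟨ -‿homo (+ suc m ℤ.* + n) ⟩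
    - ⟦ + suc m ℤ.* + n ⟧ℤ         ≈⟨ -‿cong (*-homo (+ suc m) (+ n)) ⟩
    - (suc m · 1# * n · 1#)        ≈⟨ -‿distribˡ-* _ _ ⟩
    - (suc m · 1#) * n · 1#        ∎
  *-homo -[1+ m ] -[1+ n ] = begin
    ⟦ + (suc m ℕ.* suc n) ⟧ℤ              ≈⟨ ×1-homo-* (suc m) (suc n) ⟩
    suc m · 1# * suc n · 1#               ≈⟨ -‿involutive _ ⟨
    - - (suc m · 1# * suc n · 1#)         ≈⟨ -‿cong (-‿distribʳ-* _ _) ⟩
    - (suc m · 1# * - (suc n · 1#))       ≈⟨ -‿distribˡ-* _ _ ⟩
    - (suc m · 1#) * - (suc n · 1#)       ∎

  morphism : ℤ.+-*-rawRing -Raw-AlmostCommutative⟶ fromCommutativeRing R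
  morphism = record
    { ⟦_⟧    = ⟦_⟧ℤ
    ; +-homo = +-homo
    ; *-homo = *-homo
    ; -‿homo = -‿homo
    ; 0-homo = refl
    ; 1-homo = refl
    }

  _coeff≟_ : WeaklyDecidable (Induced-equivalence morphism)
  i coeff≟ j with i ℤ.≟ j
  ... | yes ≡.refl = just refl
  ... | no  _      = nothing

  open import Algebra.Solver.Ring ℤ.+-*-rawRing (fromCommutativeRing R) morphism _coeff≟_ public
    using (solve; _:=_; _:+_; _:*_; _:-_; :-_; con)

-- Order and sign rules in the field.

module OrderedField (em : ExcludedMiddle 0ℓ) (ℝ : CompleteOrderedField) where
  open CompleteOrderedField ℝ
  open IntegerCoefficientSolver commutativeRing

  totalOrder : TotalOrder 0ℓ 0ℓ 0ℓ
  totalOrder = record { isTotalOrder = isTotalOrder }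

  open TotalOrder totalOrder public using (total; antisym)
    renaming (refl to ≤-refl; trans to ≤-trans; reflexive to ≤-reflexive)
  open TotalOrder totalOrder using (poset)
  open import Relation.Binary.Reasoning.PartialOrder poset

  private
    2# : Carrier
    2# = 1# + 1#

  ≤-respʳ : ∀ {x y z} → x ≤ y → y ≈ z → x ≤ z
  ≤-respʳ x≤y y≈z = ≤-trans x≤y (≤-reflexive y≈z)

  x≤y⇒0≤y-x : ∀ {x y} → x ≤ y → 0# ≤ y - x
  x≤y⇒0≤y-x {x} {y} x≤y = begin
    0#        ≈⟨ -‿inverseˡ x ⟨
    - x + x   ≤⟨ +-monoʳ-≤ (- x) x≤y ⟩
    - x + y   ≈⟨ +-comm _ _ ⟩
    y - x     ∎

  ≤-from-difference : ∀ {x y d} → 0# ≤ d → y - x ≈ d → x ≤ y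
  ≤-from-difference {x} {y} {d} 0≤d y-x≈d = begin
    x            ≈⟨ +-identityʳ x ⟨
    x + 0#       ≤⟨ +-monoʳ-≤ x 0≤d ⟩
    x + d        ≈⟨ +-congˡ y-x≈d ⟨
    x + (y - x)  ≈⟨ solve 2 (λ x y → x :+ (y :- x) := y) refl x y ⟩
    y            ∎

  +-nonNeg : ∀ {x y} → 0# ≤ x → 0# ≤ y → 0# ≤ x + y
  +-nonNeg {x} {y} 0≤x 0≤y = begin
    0#      ≤⟨ 0≤x ⟩
    x       ≈⟨ +-identityʳ x ⟨
    x + 0#  ≤⟨ +-monoʳ-≤ x 0≤y ⟩
    x + y   ∎

  +-mono-≤ : ∀ {w x y z} → w ≤ x → y ≤ z → w + y ≤ x + z
  +-mono-≤ {w} {x} {y} {z} w≤x y≤z = ≤-from-difference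
    (+-nonNeg (x≤y⇒0≤y-x w≤x) (x≤y⇒0≤y-x y≤z))
    (solve 4 (λ w x y z → (x :+ z) :- (w :+ y) := (x :- w) :+ (z :- y)) refl w x y z)

  *-monoʳ-≤-nonNeg : ∀ {a x y} → 0# ≤ a → x ≤ y → a * x ≤ a * y
  *-monoʳ-≤-nonNeg {a} {x} {y} 0≤a x≤y = ≤-from-difference
    (*-nonNeg 0≤a (x≤y⇒0≤y-x x≤y))
    (solve 3 (λ a x y → a :* y :- a :* x := a :* (y :- x)) refl a x y)

  x≤0⇒0≤-x : ∀ {x} → x ≤ 0# → 0# ≤ - x
  x≤0⇒0≤-x {x} x≤0 = ≤-respʳ (x≤y⇒0≤y-x x≤0) (+-identityˡ (- x))

  0≤-x⇒x≤0 : ∀ {x} → 0# ≤ - x → x ≤ 0#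
  0≤-x⇒x≤0 {x} 0≤-x = ≤-from-difference 0≤-x (+-identityˡ (- x))

  square-nonNeg : ∀ x → 0# ≤ x * x
  square-nonNeg x with total 0# x
  ... | inj₁ 0≤x = *-nonNeg 0≤x 0≤x
  ... | inj₂ x≤0 = ≤-respʳ (*-nonNeg (x≤0⇒0≤-x x≤0) (x≤0⇒0≤-x x≤0))
    (solve 1 (λ x → (:- x) :* (:- x) := x :* x) refl x)

  0≤1 : 0# ≤ 1#
  0≤1 = ≤-respʳ (square-nonNeg 1#) (*-identityˡ 1#)

  nonNeg-sum≈0 : ∀ {x y} → 0# ≤ x → 0# ≤ y → x + y ≈ 0# → x ≈ 0# × y ≈ 0#
  nonNeg-sum≈0 {x} {y} 0≤x 0≤y x+y≈0 =
    antisym (≤-from-difference 0≤y (trans (+-congʳ (sym x+y≈0)) (solve 2 (λ x y → (x :+ y) :- x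
      := y) refl x y))) 0≤x ,
    antisym (≤-from-difference 0≤x (trans (+-congʳ (sym x+y≈0)) (solve 2 (λ x y → (x :+ y) :- y
      := x) refl x y))) 0≤y

  x-y≈0⇒x≈y : ∀ {x y} → x - y ≈ 0# → x ≈ y
  x-y≈0⇒x≈y {x} {y} x-y≈0 = trans (solve 2 (λ x y → x := (x :- y) :+ y) refl x y)
    (trans (+-congʳ x-y≈0) (+-identityˡ y))

  Positive : Carrier → Set
  Positive x = 0# ≤ x × x ≉ 0#

  positive⇒≰0 : ∀ {x} → Positive x → ¬ (x ≤ 0#)
  positive⇒≰0 (0≤x , x≉0) x≤0 = x≉0 (antisym x≤0 0≤x)

  ≰⇒positive : ∀ {x y} → ¬ (x ≤ y) → Positive (x - y)
  ≰⇒positive {x} {y} x≰y with total x y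
  ... | inj₁ x≤y = contradiction x≤y x≰y
  ... | inj₂ y≤x = x≤y⇒0≤y-x y≤x , λ x-y≈0 → x≰y (≤-reflexive (x-y≈0⇒x≈y x-y≈0))

  x*y≈0⇒y≈0 : ∀ {x y} → x ≉ 0# → x * y ≈ 0# → y ≈ 0#
  x*y≈0⇒y≈0 {x} {y} x≉0 xy≈0 with inverse x x≉0
  ... | x⁻¹ , xx⁻¹≈1 = begin-equality
    y               ≈⟨ *-identityˡ y ⟨
    1# * y          ≈⟨ *-congʳ xx⁻¹≈1 ⟨
    x * x⁻¹ * y     ≈⟨ solve 3 (λ x z y → x :* z :* y := z :* (x :* y)) refl x x⁻¹ y ⟩
    x⁻¹ * (x * y)   ≈⟨ *-congˡ xy≈0 ⟩
    x⁻¹ * 0#        ≈⟨ zeroʳ x⁻¹ ⟩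
    0#              ∎

  *-cancelˡ-≉0 : ∀ {a x y} → a ≉ 0# → a * x ≈ a * y → x ≈ y
  *-cancelˡ-≉0 {a} {x} {y} a≉0 ax≈ay = x-y≈0⇒x≈y (x*y≈0⇒y≈0 a≉0 (begin-equality
    a * (x - y)     ≈⟨ solve 3 (λ a x y → a :* (x :- y) := a :* x :- a :* y) refl a x y ⟩
    a * x - a * y   ≈⟨ +-congʳ ax≈ay ⟩
    a * y - a * y   ≈⟨ -‿inverseʳ _ ⟩
    0#              ∎))

  *-≉0 : ∀ {x y} → x ≉ 0# → y ≉ 0# → x * y ≉ 0#
  *-≉0 x≉0 y≉0 xy≈0 = y≉0 (x*y≈0⇒y≈0 x≉0 xy≈0)

  square≈0⇒≈0 : ∀ {x} → x * x ≈ 0# → x ≈ 0#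
  square≈0⇒≈0 {x} xx≈0 with em {x ≈ 0#}
  ... | yes x≈0 = x≈0
  ... | no  x≉0 = x*y≈0⇒y≈0 x≉0 xx≈0

  positive-1 : Positive 1#
  positive-1 = 0≤1 , λ 1≈0 → 0≉1 (sym 1≈0)

  positive-+ : ∀ {x y} → Positive x → 0# ≤ y → Positive (x + y)
  positive-+ (0≤x , x≉0) 0≤y = +-nonNeg 0≤x 0≤y , λ x+y≈0 → x≉0 (proj₁ (nonNeg-sum≈0 0≤x 0≤y x+y≈0))

  positive-* : ∀ {x y} → Positive x → Positive y → Positive (x * y)
  positive-* (0≤x , x≉0) (0≤y , y≉0) = *-nonNeg 0≤x 0≤y , *-≉0 x≉0 y≉0

  positive-2 : Positive 2#
  positive-2 = positive-+ positive-1 0≤1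

  *-cancelˡ-nonNeg : ∀ {a x} → Positive a → 0# ≤ a * x → 0# ≤ x
  *-cancelˡ-nonNeg {a} {x} (0≤a , a≉0) 0≤ax with total 0# x
  ... | inj₁ 0≤x = 0≤x
  ... | inj₂ x≤0 = ≤-reflexive (sym (x*y≈0⇒y≈0 a≉0 (antisym
    (0≤-x⇒x≤0 (≤-respʳ (*-nonNeg 0≤a (x≤0⇒0≤-x x≤0)) (solve 2 (λ a x → a :* (:- x)
      := :- (a :* x)) refl a x)))
    0≤ax)))

  *-cancelˡ-≤ : ∀ {a x y} → Positive a → a * x ≤ a * y → x ≤ y
  *-cancelˡ-≤ {a} {x} {y} a>0 ax≤ay = ≤-from-difference
    (*-cancelˡ-nonNeg a>0 (≤-respʳ (x≤y⇒0≤y-x ax≤ay)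
      (solve 3 (λ a x y → a :* y :- a :* x := a :* (y :- x)) refl a x y)))
    refl

  positive-inverse : ∀ {x y} → Positive x → x * y ≈ 1# → Positive y
  positive-inverse {x} {y} x>0 xy≈1 =
    *-cancelˡ-nonNeg x>0 (≤-respʳ 0≤1 (sym xy≈1)) ,
    λ y≈0 → 0≉1 (trans (sym (zeroʳ x)) (trans (*-congˡ (sym y≈0)) xy≈1))

  -- The lower bound 1 serves the two uses: it gives `K ≤ K³` in `cubeRoot`, and a positive, hence
  -- invertible, constant in `coercive`.
  absoluteBound : ∀ a → Σ[ K ∈ Carrier ] 1# ≤ K × a ≤ K × - K ≤ a
  absoluteBound a with total 0# a
  ... | inj₁ 0≤a = 1# + a ,
    ≤-from-difference 0≤a (solve 1 (λ a → (con (+ 1) :+ a) :- con (+ 1) := a) refl a) ,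
    ≤-from-difference 0≤1 (solve 1 (λ a → (con (+ 1) :+ a) :- a := con (+ 1)) refl a) ,
    ≤-from-difference (+-nonNeg (+-nonNeg 0≤a 0≤1) 0≤a)
      (solve 1 (λ a → a :- (:- (con (+ 1) :+ a)) := (a :+ con (+ 1)) :+ a) refl a)
  ... | inj₂ a≤0 = 1# - a ,
    ≤-from-difference (x≤0⇒0≤-x a≤0) (solve 1 (λ a → (con (+ 1) :- a) :- con (+ 1) := :- a) refl a) ,
    ≤-from-difference (+-nonNeg (+-nonNeg (x≤0⇒0≤-x a≤0) 0≤1) (x≤0⇒0≤-x a≤0))
      (solve 1 (λ a → (con (+ 1) :- a) :- a := ((:- a) :+ con (+ 1)) :+ (:- a)) refl a) ,
    ≤-from-difference 0≤1 (solve 1 (λ a → a :- (:- (con (+ 1) :- a)) := con (+ 1)) refl a)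

  -- Cube roots as suprema.

  private
    cubed : Carrier → Carrier
    cubed x = x * x * x

  -- The factor `Q` is twice `x² + xy + y²`, written as a sum of squares. If `y ≤ x` but the two
  -- differ, the factorisation forces `Q` to vanish, and then both `x` and `y` are 0.
  cube-cancel-≤ : ∀ {x y} → x * x * x ≤ y * y * y → x ≤ y
  cube-cancel-≤ {x} {y} x³≤y³ with total x y
  ... | inj₁ x≤y = x≤y
  ... | inj₂ y≤x with em {x - y ≈ 0#}
  ...   | yes x-y≈0 = ≤-reflexive (x-y≈0⇒x≈y x-y≈0)
  ...   | no  x-y≉0 = ≤-reflexive (trans x≈0 (sym y≈0))
    where
    Q : Carrier
    Q = x * x + y * y + (x + y) * (x + y)

    0≤x²+y² : 0# ≤ x * x + y * y
    0≤x²+y² = +-nonNeg (square-nonNeg x) (square-nonNeg y)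

    -- (x - y) Q = 2 (x³ - y³)
    [x-y]Q≈0 : (x - y) * Q ≈ 0#
    [x-y]Q≈0 = antisym
      (≤-from-difference (*-nonNeg (proj₁ positive-2) (x≤y⇒0≤y-x x³≤y³))
        (solve 2 (λ x y → con (+ 0) :- (x :- y) :* (x :* x :+ y :* y :+ (x :+ y) :* (x :+ y))
                       := con (+ 2) :* (y :* y :* y :- x :* x :* x)) refl x y))
      (*-nonNeg (x≤y⇒0≤y-x y≤x) (+-nonNeg 0≤x²+y² (square-nonNeg (x + y))))

    squares≈0 : x * x ≈ 0# × y * y ≈ 0#
    squares≈0 = nonNeg-sum≈0 (square-nonNeg x) (square-nonNeg y)
      (proj₁ (nonNeg-sum≈0 0≤x²+y² (square-nonNeg (x + y)) (x*y≈0⇒y≈0 x-y≉0 [x-y]Q≈0)))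

    x≈0 : x ≈ 0#
    x≈0 = square≈0⇒≈0 (proj₁ squares≈0)

    y≈0 : y ≈ 0#
    y≈0 = square≈0⇒≈0 (proj₂ squares≈0)

  private
    -- A generous bound for the difference quotient `3s² + 3se + e²` of cubing at `s`, valid for all
    -- steps with `e² ≤ 1`. The constant inside keeps it positive even at `s = 0`.
    slope : Carrier → Carrier
    slope s = 2# * (s * s + s * s + s * s + 2#)

    quotient : Carrier → Carrier → Carrier
    quotient s e = s * s + s * s + s * s + (s * e + s * e + s * e) + e * e

    cube-+ : ∀ s e → cubed (s + e) ≈ cubed s + e * quotient s e
    cube-+ = solve 2 (λ s e → (s :+ e) :* (s :+ e) :* (s :+ e) :=
      s :* s :* s :+ e :* (s :* s :+ s :* s :+ s :* s :+ (s :* e :+ s :* e :+ s :* e) :+ e :* e)) refl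

  positive-slope : ∀ s → Positive (slope s)
  positive-slope s = positive-* positive-2 ((+-nonNeg (+-nonNeg (+-nonNeg ss ss) ss) (proj₁ positive-2)) ,
    λ eq → proj₂ positive-2 (proj₂ (nonNeg-sum≈0 (+-nonNeg (+-nonNeg ss ss) ss) (proj₁ positive-2) eq)))
    where ss = square-nonNeg s

  slope-bound : ∀ s e → e * e ≤ 1# → quotient s e ≤ slope s
  -- Doubled, so that `3(s - e)²` absorbs the cross term `6se` without halves.
  slope-bound s e e²≤1 = *-cancelˡ-≤ positive-2 (≤-from-difference
    (+-nonNeg (+-nonNeg (three (square-nonNeg s)) (three (square-nonNeg (s - e))))
              (+-nonNeg (three 0≤1) (+-nonNeg (three 0≤1-e²) (+-nonNeg 0≤1-e² 0≤1-e²))))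
    (solve 2 (λ s e → let three = λ x → x :+ x :+ x ; s² = s :* s ; d = con (+ 1) :- e :* e in
       con (+ 2) :* (con (+ 2) :* (s² :+ s² :+ s² :+ con (+ 2))) :-
       con (+ 2) :* (s² :+ s² :+ s² :+ (s :* e :+ s :* e :+ s :* e) :+ e :* e)
       := (three s² :+ three ((s :- e) :* (s :- e))) :+ (three (con (+ 1)) :+ (three d :+ (d :+ d))))
      refl s e))
    where
    three : ∀ {x} → 0# ≤ x → 0# ≤ x + x + x
    three 0≤x = +-nonNeg (+-nonNeg 0≤x 0≤x) 0≤x

    0≤1-e² : 0# ≤ 1# - e * e
    0≤1-e² = x≤y⇒0≤y-x e²≤1

  -- The witness `d / (M + d)` meets both bounds at once: it is at most 1 because `M` is positive,
  -- and `d - eM = de` is nonnegative.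
  smallStep : ∀ {M d} → Positive M → Positive d →
              Σ[ e ∈ Carrier ] Positive e × e * e ≤ 1# × e * M ≤ d
  smallStep {M} {d} M>0 d>0 = e , e>0 , e²≤1 , eM≤d
    where
    M+d>0 : Positive (M + d)
    M+d>0 = positive-+ M>0 (proj₁ d>0)

    i : Carrier
    i = proj₁ (inverse (M + d) (proj₂ M+d>0))

    [M+d]i≈1 : (M + d) * i ≈ 1#
    [M+d]i≈1 = proj₂ (inverse (M + d) (proj₂ M+d>0))

    i>0 : Positive i
    i>0 = positive-inverse M+d>0 [M+d]i≈1

    e : Carrier
    e = d * i

    e>0 : Positive e
    e>0 = positive-* d>0 i>0

    e≤1 : e ≤ 1#
    e≤1 = ≤-from-difference (*-nonNeg (proj₁ M>0) (proj₁ i>0))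
      (trans (+-congʳ (sym [M+d]i≈1)) (solve 3 (λ M d i → (M :+ d) :* i :- d :* i := M :* i)
        refl M d i))

    e²≤1 : e * e ≤ 1#
    e²≤1 = ≤-trans (*-monoʳ-≤-nonNeg (proj₁ e>0) e≤1) (≤-trans (≤-reflexive (*-identityʳ e)) e≤1)

    eM≤d : e * M ≤ d
    eM≤d = ≤-from-difference (*-nonNeg (proj₁ d>0) (proj₁ e>0)) (begin-equality
      d - e * M                       ≈⟨ +-congʳ (*-identityʳ d) ⟨
      d * 1# - e * M                  ≈⟨ +-congʳ (*-congˡ [M+d]i≈1) ⟨
      d * ((M + d) * i) - d * i * M   ≈⟨ solve 3 (λ M d i → d :* ((M :+ d) :* i) :- d :* i :* M
        := d :* (d :* i)) refl M d i ⟩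
      d * (d * i)                     ∎)

  private
    split-difference₁ : ∀ a S e M Q → a - (S + e * Q) ≈ (a - S - e * M) + (e * M - e * Q)
    split-difference₁ = solve 5 (λ a S e M Q → a :- (S :+ e :* Q)
      := ((a :- S) :- e :* M) :+ (e :* M :- e :* Q)) refl

    split-difference₂ : ∀ a S e M Q → (S + - e * Q) - a ≈ (S - a - e * M) + (e * M - e * Q)
    split-difference₂ = solve 5 (λ a S e M Q → (S :+ (:- e) :* Q) :- a
      := ((S :- a) :- e :* M) :+ (e :* M :- e :* Q)) refl

    CubeBelow : Carrier → Carrier → Set
    CubeBelow a t = cubed t ≤ a

    no-step : ∀ {x y e} → Positive e → y - x ≈ - e → ¬ (x ≤ y)
    no-step e>0 y-x≈-e x≤y = positive⇒≰0 e>0 (0≤-x⇒x≤0 (≤-respʳ (x≤y⇒0≤y-x x≤y) y-x≈-e))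

    step-up : ∀ {a s e} → Positive e → e * e ≤ 1# → e * slope s ≤ a - cubed s → CubeBelow a (s + e)
    step-up {a} {s} {e} e>0 e²≤1 eM≤d = ≤-trans (≤-reflexive (cube-+ s e)) (≤-from-difference
      (+-nonNeg (x≤y⇒0≤y-x eM≤d) (x≤y⇒0≤y-x (*-monoʳ-≤-nonNeg (proj₁ e>0) (slope-bound s e e²≤1))))
      (split-difference₁ a (cubed s) e (slope s) (quotient s e)))

    step-down : ∀ {a s e} → Positive e → e * e ≤ 1# → e * slope s ≤ cubed s - a → a ≤ cubed (s - e)
    step-down {a} {s} {e} e>0 e²≤1 eM≤d = ≤-respʳ (≤-from-difference
      (+-nonNeg (x≤y⇒0≤y-x eM≤d) (x≤y⇒0≤y-x (*-monoʳ-≤-nonNeg (proj₁ e>0) (slope-bound s (- e) [-e]²≤1))))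
      (split-difference₂ a (cubed s) e (slope s) (quotient s (- e)))) (sym (cube-+ s (- e)))
      where
      [-e]²≤1 : - e * - e ≤ 1#
      [-e]²≤1 = ≤-trans (≤-reflexive (solve 1 (λ e → (:- e) :* (:- e) := e :* e) refl e)) e²≤1

  -- If the cube of `s` were below `a`, a small step up would stay in the set and pass its upper
  -- bound.
  upperBound⇒≤cube : ∀ {a s} → UpperBound (CubeBelow a) s → a ≤ s * s * s
  upperBound⇒≤cube {a} {s} s-bound with em {a ≤ cubed s}
  ... | yes p = p
  ... | no ¬p =
    let e , e>0 , e²≤1 , eM≤d = smallStep (positive-slope s) (≰⇒positive ¬p) in
    contradiction (s-bound (s + e) (step-up e>0 e²≤1 eM≤d))
      (no-step e>0 (solve 2 (λ s e → s :- (s :+ e) := :- e) refl s e))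

  -- If the cube of `s` were above `a`, a small step down would still have its cube above `a`; by
  -- monotonicity of cubing it would be a smaller upper bound.
  leastUpperBound⇒cube≤ : ∀ {a s} → (∀ b → UpperBound (CubeBelow a) b → s ≤ b) → s * s * s ≤ a
  leastUpperBound⇒cube≤ {a} {s} s-least with em {cubed s ≤ a}
  ... | yes p = p
  ... | no ¬p =
    let e , e>0 , e²≤1 , eM≤d = smallStep (positive-slope s) (≰⇒positive ¬p) in
    contradiction (s-least (s - e) (λ t t³≤a → cube-cancel-≤ (≤-trans t³≤a (step-down e>0 e²≤1 eM≤d))))
      (no-step e>0 (solve 2 (λ s e → (s :- e) :- s := :- e) refl s e))

  -- This is what lets a real coefficient of either sign be absorbed into the vector of a rank-one
  -- term of order 3.
  cubeRoot : ∀ a → ∃[ c ] c * c * c ≈ a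
  cubeRoot a with absoluteBound a
  ... | K , 1≤K , a≤K , -K≤a = s , antisym (leastUpperBound⇒cube≤ s-least) (upperBound⇒≤cube s-bound)
    where
    K≤K³ : K ≤ cubed K
    K≤K³ = begin
      K           ≈⟨ *-identityʳ K ⟨
      K * 1#      ≤⟨ *-monoʳ-≤-nonNeg 0≤K 1≤K ⟩
      K * K       ≈⟨ *-identityʳ _ ⟨
      K * K * 1#  ≤⟨ *-monoʳ-≤-nonNeg (square-nonNeg K) 1≤K ⟩
      K * K * K   ∎
      where
      0≤K : 0# ≤ K
      0≤K = ≤-trans 0≤1 1≤K

    -K-below : CubeBelow a (- K)
    -K-below = begin
      cubed (- K)  ≤⟨ ≤-from-difference (x≤y⇒0≤y-x K≤K³)
        (solve 1 (λ K → (:- K) :- (:- K) :* (:- K) :* (:- K) := K :* K :* K :- K) refl K) ⟩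
      - K          ≤⟨ -K≤a ⟩
      a            ∎

    K-bound : UpperBound (CubeBelow a) K
    K-bound t t³≤a = cube-cancel-≤ (≤-trans t³≤a (≤-trans a≤K K≤K³))

    sup = supremum (CubeBelow a) (- K , -K-below) (K , K-bound)

    s : Carrier
    s = proj₁ sup

    s-bound : UpperBound (CubeBelow a) s
    s-bound = proj₁ (proj₂ sup)

    s-least : ∀ b → UpperBound (CubeBelow a) b → s ≤ b
    s-least = proj₂ (proj₂ sup)

-- Linear dependence, bases and rank.

module LinearAlgebra (em : ExcludedMiddle 0ℓ) (ℝ : CompleteOrderedField) where
  open CompleteOrderedField ℝ hiding (zero)
  open Tensors ℝ
  open IntegerCoefficientSolver commutativeRing
  open import Algebra.Properties.Semiring.Sum semiring public
  open import Relation.Binary.Reasoning.Setoid setoid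

  V : ℕ → Set
  V n = Fin n → Carrier

  private variable
    I : Set
    k m n : ℕ

  infix 4 _≋_
  _≋_ : {I : Set} → (I → Carrier) → (I → Carrier) → Set
  x ≋ y = ∀ i → x i ≈ y i

  infixl 6 _⊕_
  _⊕_ : {I : Set} → (I → Carrier) → (I → Carrier) → I → Carrier
  (x ⊕ y) i = x i + y i

  infixr 7 _•_
  _•_ : {I : Set} → Carrier → (I → Carrier) → I → Carrier
  (a • x) i = a * x i

  0v : {I : Set} → I → Carrier
  0v _ = 0#

  sum-zero : {x : V n} → x ≋ 0v → sum x ≈ 0#
  sum-zero {n} x≋0 = trans (sum-cong-≋ x≋0) (sum-replicate-zero n)

  lincomb-cong : ∀ {c d : V m} {v w : Vector (I → Carrier) m} →
                 c ≋ d → (∀ k → v k ≋ w k) → lincomb c v ≋ lincomb d w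
  lincomb-cong c≋d v≋w i = sum-cong-≋ λ k → *-cong (c≋d k) (v≋w k i)

  lincomb-zero : ∀ {c : V m} {v : Vector (I → Carrier) m} → c ≋ 0v → lincomb c v ≋ 0v
  lincomb-zero {m = m} {v = v} c≋0 i = sum-zero {m} λ k → trans (*-congʳ (c≋0 k)) (zeroˡ (v k i))

  lincomb-⊕ : ∀ (c d : V m) (v : Vector (I → Carrier) m) →
              lincomb (c ⊕ d) v ≋ lincomb c v ⊕ lincomb d v
  lincomb-⊕ {m = m} c d v i = trans (sum-cong-≋ λ k →
    distribʳ (v k i) (c k) (d k)) (∑-distrib-+ {m} _ _)

  lincomb-• : ∀ a (c : V m) (v : Vector (I → Carrier) m) →
              lincomb (a • c) v ≋ a • lincomb c v
  lincomb-• {m = m} a c v i = trans (sum-cong-≋ λ k → *-assoc a (c k) (v k i))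
    (sym (*-distribˡ-sum {m} a _))

  -- Associativity of the matrix product, `c (D B) = (c D) B`, with rows as vectors.
  lincomb-lincomb : ∀ (c : V m) (d : Vector (V k) m) (b : Vector (I → Carrier) k) →
                    lincomb c (λ l → lincomb (d l) b) ≋ lincomb (lincomb c d) b
  lincomb-lincomb {m = m} {k = k} c d b i = begin
    (∑[ l < _ ] (c l * ∑[ s < _ ] (d l s * b s i)))
      ≈⟨ sum-cong-≋ (λ l → trans (*-distribˡ-sum {k} (c l) _) (sum-cong-≋ λ s →
        sym (*-assoc (c l) (d l s) (b s i)))) ⟩
    (∑[ l < _ ] ∑[ s < _ ] (c l * d l s * b s i))
      ≈⟨ ∑-comm (λ l s → c l * d l s * b s i) ⟩
    (∑[ s < _ ] ∑[ l < _ ] (c l * d l s * b s i))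
      ≈⟨ sum-cong-≋ (λ s → sym (*-distribʳ-sum {m} (b s i) (λ l → c l * d l s))) ⟩
    (∑[ s < _ ] ((∑[ l < _ ] (c l * d l s)) * b s i)) ∎

  ∈Span-trans : ∀ {w : I → Carrier} {v : Vector (I → Carrier) m} {b : Vector (I → Carrier) k} →
                w ∈Span v → (∀ l → v l ∈Span b) → w ∈Span b
  ∈Span-trans {b = b} (c , w≋) v∈ = lincomb c (proj₁ ∘ v∈) , λ i → trans (w≋ i)
    (trans (lincomb-cong {c = c} (λ _ → refl) (proj₂ ∘ v∈) i) (lincomb-lincomb c (proj₁ ∘ v∈) b i))

  unit : Fin n → V n
  unit zero    zero    = 1#
  unit zero    (suc _) = 0#
  unit (suc _) zero    = 0#
  unit (suc i) (suc j) = unit i j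

  lincomb-unit : (x : V n) → lincomb x unit ≋ x
  lincomb-unit {n = suc n} x zero = trans (+-cong
    (*-identityʳ _) (sum-zero {n} λ k → zeroʳ _)) (+-identityʳ _)
  lincomb-unit x (suc i) = trans (+-cong (zeroʳ _) (lincomb-unit (x ∘ suc) i)) (+-identityˡ _)

  lincomb-unitˡ : (i : Fin n) (v : Vector (I → Carrier) n) → lincomb (unit i) v ≋ v i
  lincomb-unitˡ {n = suc n} zero v j = trans (+-cong
    (*-identityˡ _) (sum-zero {n} λ k → zeroˡ _)) (+-identityʳ _)
  lincomb-unitˡ (suc i) v j = trans (+-cong (zeroˡ _) (lincomb-unitˡ i (v ∘ suc) j)) (+-identityˡ _)

  ∈Span-member : (v : Vector (I → Carrier) m) → ∀ l → v l ∈Span v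
  ∈Span-member v l = unit l , λ i → sym (lincomb-unitˡ l v i)

  record IsLinear (f : V m → V n) : Set where
    field
      cong      : ∀ {x y} → x ≋ y → f x ≋ f y
      additive  : ∀ x y → f (x ⊕ y) ≋ f x ⊕ f y
      homogeneous : ∀ a x → f (a • x) ≋ a • f x

    zero-homo : f 0v ≋ 0v
    zero-homo i = begin
      f 0v i          ≈⟨ cong (λ _ → sym (zeroˡ 0#)) i ⟩
      f (0# • 0v) i   ≈⟨ homogeneous 0# 0v i ⟩
      0# * f 0v i     ≈⟨ zeroˡ _ ⟩
      0#              ∎

    lincomb-homo : ∀ (c : V k) (v : Vector (V m) k) → f (lincomb c v) ≋ lincomb c (f ∘ v)
    lincomb-homo {zero}  c v i = zero-homo i
    lincomb-homo {suc _} c v i = trans (additive _ _ i)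
      (+-cong (homogeneous (c zero) (v zero) i) (lincomb-homo (c ∘ suc) (v ∘ suc) i))

  Nontrivial : V m → Set
  Nontrivial c = ∃[ l ] c l ≉ 0#

  nontrivial? : (c : V m) → Nontrivial c ⊎ c ≋ 0v
  nontrivial? c with em {Nontrivial c}
  ... | yes p = inj₁ p
  ... | no ¬p = inj₂ λ i → decide i
    where
    decide : ∀ i → c i ≈ 0#
    decide i with em {c i ≈ 0#}
    ... | yes ci≈0 = ci≈0
    ... | no  ci≉0 = contradiction (i , ci≉0) ¬p

  eliminate : ∀ {p q} x → p * q ≈ 1# → x + - (x * q) * p ≈ 0#
  eliminate {p} {q} x pq≈1 = begin
    x + - (x * q) * p  ≈⟨ solve 3 (λ x p q → x :+ (:- (x :* q)) :* p := x :- x :* (p :* q)) refl x p q ⟩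
    x - x * (p * q)    ≈⟨ +-congˡ (-‿cong (trans (*-congˡ pq≈1) (*-identityʳ x))) ⟩
    x - x              ≈⟨ -‿inverseʳ x ⟩
    0#                 ∎

  -- Gaussian elimination: a nonzero entry i of the first vector clears
  -- coordinate i of all the others, which leaves one coordinate fewer.
  dependent : ∀ k (v : Vector (V k) m) → k ℕ.< m →
              ∃[ c ] Nontrivial c × lincomb c v ≋ 0v
  dependent zero v (ℕ.s≤s _) = unit zero , (zero , λ 1≈0 → 0≉1 (sym 1≈0)) , λ ()
  dependent (suc k) v (ℕ.s≤s {n = m} k<m) with nontrivial? (v zero)
  ... | inj₂ v₀≋0 = unit zero , (zero , λ 1≈0 → 0≉1 (sym 1≈0)) ,
    λ i → trans (lincomb-unitˡ zero v i) (v₀≋0 i)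
  ... | inj₁ (i , p≉0) = (c₀ ∷ c) , (suc l , cₗ≉0) , relation
    where
    q : Carrier
    q = proj₁ (inverse (v zero i) p≉0)

    factor : V m
    factor l = - (v (suc l) i * q)

    w : Vector (V (suc k)) m
    w l = v (suc l) ⊕ factor l • v zero

    recurse = dependent k (λ l j → w l (punchIn i j)) k<m

    c : V m
    c = proj₁ recurse

    l : Fin m
    l = proj₁ (proj₁ (proj₂ recurse))

    cₗ≉0 : c l ≉ 0#
    cₗ≉0 = proj₂ (proj₁ (proj₂ recurse))

    c₀ : Carrier
    c₀ = ∑[ l < m ] (c l * factor l)

    w-relation : lincomb c w ≋ 0v
    w-relation j with i Fin.≟ j
    ... | yes ≡.refl = sum-zero {m} λ l → trans
      (*-congˡ (eliminate (v (suc l) i) (proj₂ (inverse (v zero i) p≉0)))) (zeroʳ (c l))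
    ... | no i≢j = ≡.subst (λ j → lincomb c w j ≈ 0#) (Fin.punchIn-punchOut i≢j)
      (proj₂ (proj₂ recurse) (punchOut i≢j))

    relation : lincomb (c₀ ∷ c) v ≋ 0v
    relation j = begin
      c₀ * v zero j + lincomb c (v ∘ suc) j
        ≈⟨ +-comm _ _ ⟩
      lincomb c (v ∘ suc) j + c₀ * v zero j
        ≈⟨ +-congˡ (trans (*-distribʳ-sum {m} (v zero j) (λ l → c l * factor l)) (sum-cong-≋ λ l →
          *-assoc (c l) (factor l) (v zero j))) ⟩
      lincomb c (v ∘ suc) j + (∑[ l < m ] (c l * (factor l * v zero j)))
        ≈⟨ ∑-distrib-+ {m} _ _ ⟨
      (∑[ l < m ] (c l * v (suc l) j + c l * (factor l * v zero j)))
        ≈⟨ sum-cong-≋ (λ l → sym (distribˡ (c l) _ _)) ⟩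
      lincomb c w j
        ≈⟨ w-relation j ⟩
      0# ∎

  -- More than `k` coordinate vectors in `V k` are dependent, and a relation between the coordinates
  -- is one between the vectors.
  independent⇒≤ : ∀ {v : Vector (I → Carrier) m} {b : Vector (I → Carrier) k} →
                  LinearlyIndependent v → (∀ l → v l ∈Span b) → m ℕ.≤ k
  independent⇒≤ {m = m} {k = k} {v = v} {b = b} v-independent v∈ with m ℕ.≤? k
  ... | yes m≤k = m≤k
  ... | no  m≰k = contradiction (v-independent c relation l) cₗ≉0
    where
    dep = dependent k (proj₁ ∘ v∈) (ℕ.≰⇒> m≰k)

    c = proj₁ dep
    l = proj₁ (proj₁ (proj₂ dep))
    cₗ≉0 = proj₂ (proj₁ (proj₂ dep))

    relation : lincomb c v ≋ 0v
    relation i = begin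
      lincomb c v i                              ≈⟨ lincomb-cong {c = c} (λ _ → refl) (proj₂ ∘ v∈) i ⟩
      lincomb c (λ l → lincomb (proj₁ (v∈ l)) b) i  ≈⟨ lincomb-lincomb c _ b i ⟩
      lincomb (lincomb c (proj₁ ∘ v∈)) b i          ≈⟨ lincomb-zero {v = b} (proj₂ (proj₂ dep)) i ⟩
      0#                                         ∎

  solveFor : ∀ {a a⁻¹ x y} → a * a⁻¹ ≈ 1# → a * x + y ≈ 0# → x ≈ - a⁻¹ * y
  solveFor {a} {b} {x} {y} ab≈1 ax+y≈0 = begin
    x                          ≈⟨ *-identityʳ x ⟨
    x * 1#                     ≈⟨ *-congˡ ab≈1 ⟨
    x * (a * b)                ≈⟨ solve 4 (λ a b x y → x :* (a :* b)
      := b :* (a :* x :+ y) :+ (:- b) :* y) refl a b x y ⟩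
    b * (a * x + y) + - b * y  ≈⟨ +-congʳ (trans (*-congˡ ax+y≈0) (zeroʳ b)) ⟩
    0# + - b * y               ≈⟨ +-identityˡ _ ⟩
    - b * y                    ∎

  independent-∷ : ∀ {w : I → Carrier} {v : Vector (I → Carrier) m} →
                  LinearlyIndependent v → ¬ (w ∈Span v) → LinearlyIndependent (w ∷ v)
  independent-∷ {w = w} {v = v} v-independent w∉ c relation with em {c zero ≈ 0#}
  ... | no c₀≉0 = contradiction (- c₀⁻¹ • (c ∘ suc) ,
      λ i → trans (solveFor c₀c₀⁻¹≈1 (relation i)) (sym (lincomb-• (- c₀⁻¹) (c ∘ suc) v i))) w∉
    where
    c₀⁻¹ = proj₁ (inverse (c zero) c₀≉0)
    c₀c₀⁻¹≈1 = proj₂ (inverse (c zero) c₀≉0)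
  ... | yes c₀≈0 = λ where
    zero    → c₀≈0
    (suc l) → v-independent (c ∘ suc) (λ i → trans
      (sym (trans (+-congʳ (trans (*-congʳ c₀≈0) (zeroˡ (w i)))) (+-identityˡ _))) (relation i)) l

  -- The images of the standard basis are independent. A vector outside their span would extend them
  -- to `n + 1` independent vectors in `V n`.
  injective⇒surjective : ∀ {f : V n → V n} → IsLinear f → (∀ x → f x ≋ 0v → x ≋ 0v) →
                         ∀ y → ∃[ x ] f x ≋ y
  injective⇒surjective {n} {f} f-linear f-injective y with em {y ∈Span (f ∘ unit)}
  ... | yes (c , y≋) = c , λ i → sym (trans (y≋ i)
    (trans (sym (lincomb-homo c unit i)) (cong (lincomb-unit c) i)))
    where open IsLinear f-linear
  ... | no y∉ = contradiction
    (independent⇒≤ (independent-∷ columns-independent y∉) (λ l → (y ∷ f ∘ unit) l , λ i →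
      sym (lincomb-unit ((y ∷ f ∘ unit) l) i)))
    ℕ.1+n≰n
    where
    open IsLinear f-linear
    columns-independent : LinearlyIndependent (f ∘ unit)
    columns-independent c relation i = trans (sym (lincomb-unit c i))
      (f-injective (lincomb c unit) (λ j → trans (lincomb-homo c unit j) (relation j)) i)

  -- This finds a place where `P` stops, not necessarily the largest number satisfying it; a family
  -- that cannot be extended is enough for a basis. In `search`, `d` bounds the steps that remain.
  maximal : ∀ (P : ℕ → Set) r → P 0 → (∀ k → P k → k ℕ.≤ r) → ∃[ k ] P k × ¬ P (suc k)
  maximal P r P0 P⇒≤r = search r 0 P0 (ℕ.≤-reflexive (≡.sym (ℕ.+-identityʳ r)))
    where
    search : ∀ d k → P k → r ℕ.≤ d ℕ.+ k → ∃[ k ] P k × ¬ P (suc k)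
    search d k Pk r≤d+k with em {P (suc k)}
    ... | no ¬P = k , Pk , ¬P
    search zero    k Pk r≤k   | yes P[1+k] = contradiction (ℕ.≤-trans (P⇒≤r _ P[1+k]) r≤k) ℕ.1+n≰n
    search (suc d) k Pk r≤d+k | yes P[1+k] = search d (suc k) P[1+k]
      (ℕ.≤-trans r≤d+k (ℕ.≤-reflexive (≡.sym (ℕ.+-suc d k))))

  -- `Rank≤` asks for an actual basis of the column space. An independent family of maximal length
  -- in that space is one, and the spanning vectors bound its length.
  spanned⇒Rank≤ : ∀ {r} (M : Matrix n) (b : Vector (V n) r) →
                  (∀ j → column M j ∈Span b) → Rank≤ M r
  spanned⇒Rank≤ {n} {r} M b M∈ with maximal IndependentColumns r ((λ ()) , (λ _ _ ()) , λ ()) bounded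
    where
    IndependentColumns : ℕ → Set
    IndependentColumns k = Σ[ v ∈ Vector (V n) k ] LinearlyIndependent v × (∀ l → v l ∈Span column M)

    bounded : ∀ k → IndependentColumns k → k ℕ.≤ r
    bounded k (v , v-independent , v∈) = independent⇒≤ v-independent (λ l → ∈Span-trans (v∈ l) M∈)
  ... | k , (v , v-independent , v∈) , ¬P =
    k , (v , v-independent , v∈ , columns∈) ,
    independent⇒≤ v-independent (λ l → ∈Span-trans (v∈ l) M∈)
    where
    columns∈ : ∀ j → column M j ∈Span v
    columns∈ j with em {column M j ∈Span v}
    ... | yes p = p
    ... | no ¬p = contradiction (column M j ∷ v , independent-∷ v-independent ¬p , λ where
      zero    → ∈Span-member (column M) j
      (suc l) → v∈ l) ¬P

  -- Expresses that the rank of `f` is at least `k`. Its negation at `suc r` is the form in which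
  -- "rank at most `r`" is used for maps.
  IndependentImages : (V m → V n) → ℕ → Set
  IndependentImages {m} f k = Σ[ x ∈ Vector (V m) k ] LinearlyIndependent (f ∘ x)

  Rank≤⇒dependent : ∀ {r} (M : Matrix n) → Rank≤ M r →
                    ¬ IndependentImages (λ x → lincomb x (column M)) (suc r)
  Rank≤⇒dependent M (k , (b , _ , _ , columns∈) , k≤r) (x , x-independent) = contradiction
    (ℕ.≤-trans (independent⇒≤ x-independent (λ l → ∈Span-trans (x l , λ _ → refl) columns∈)) k≤r)
    ℕ.1+n≰n

-- The inner product and bounded quadratic forms.

module Spectral (em : ExcludedMiddle 0ℓ) (ℝ : CompleteOrderedField) where
  open CompleteOrderedField ℝ hiding (zero)
  open Tensors ℝ
  open IntegerCoefficientSolver commutativeRing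
  open OrderedField em ℝ
  open LinearAlgebra em ℝ

  open import Algebra.Properties.Ring ring using (-0#≈0#)
  open import Relation.Binary.Reasoning.PartialOrder (TotalOrder.poset totalOrder)

  private variable
    m n : ℕ

  infixl 8 _∙_
  _∙_ : V n → V n → Carrier
  _∙_ {n} x y = ∑[ i < n ] (x i * y i)

  ∙-cong : {w x y z : V n} → w ≋ x → y ≋ z → w ∙ y ≈ x ∙ z
  ∙-cong w≋x y≋z = sum-cong-≋ λ i → *-cong (w≋x i) (y≋z i)

  ∙-comm : (x y : V n) → x ∙ y ≈ y ∙ x
  ∙-comm x y = sum-cong-≋ λ i → *-comm (x i) (y i)

  ∙-distribʳ-⊕ : (x y z : V n) → (x ⊕ y) ∙ z ≈ x ∙ z + y ∙ z
  ∙-distribʳ-⊕ {n} x y z = trans (sum-cong-≋ λ i → distribʳ (z i) (x i) (y i)) (∑-distrib-+ {n} _ _)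

  ∙-distribˡ-⊕ : (x y z : V n) → x ∙ (y ⊕ z) ≈ x ∙ y + x ∙ z
  ∙-distribˡ-⊕ x y z = trans (∙-comm x (y ⊕ z)) (trans (∙-distribʳ-⊕ y z x)
    (+-cong (∙-comm y x) (∙-comm z x)))

  •-∙ : ∀ a (x y : V n) → (a • x) ∙ y ≈ a * (x ∙ y)
  •-∙ {n} a x y = trans (sum-cong-≋ λ i → *-assoc a (x i) (y i)) (sym (*-distribˡ-sum {n} a _))

  ∙-• : ∀ a (x y : V n) → x ∙ (a • y) ≈ a * (x ∙ y)
  ∙-• a x y = trans (∙-comm x (a • y)) (trans (•-∙ a y x) (*-congˡ (∙-comm y x)))

  ∙-zeroʳ : (x : V n) {y : V n} → y ≋ 0v → x ∙ y ≈ 0#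
  ∙-zeroʳ {n} x y≋0 = sum-zero {n} λ i → trans (*-congˡ (y≋0 i)) (zeroʳ (x i))

  ∙-lincomb : (x : V n) (c : V m) (v : Vector (V n) m) →
              x ∙ lincomb c v ≈ ∑[ k < m ] (c k * (x ∙ v k))
  ∙-lincomb {n} {m} x c v = begin-equality
    (∑[ i < n ] (x i * ∑[ k < m ] (c k * v k i)))
      ≈⟨ sum-cong-≋ (λ i → trans (*-distribˡ-sum {m} (x i) _) (sum-cong-≋ λ k →
           solve 3 (λ x c v → x :* (c :* v) := c :* (x :* v)) refl (x i) (c k) (v k i))) ⟩
    (∑[ i < n ] ∑[ k < m ] (c k * (x i * v k i)))
      ≈⟨ ∑-comm (λ i k → c k * (x i * v k i)) ⟩
    (∑[ k < m ] ∑[ i < n ] (c k * (x i * v k i)))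
      ≈⟨ sum-cong-≋ (λ k → sym (*-distribˡ-sum {n} (c k) _)) ⟩
    (∑[ k < m ] (c k * (x ∙ v k))) ∎

  [p+aq]∙[x+bz] : ∀ (p q x z : V n) a b →
    (p ⊕ a • q) ∙ (x ⊕ b • z) ≈ p ∙ x + b * (p ∙ z) + (a * (q ∙ x) + a * (b * (q ∙ z)))
  [p+aq]∙[x+bz] p q x z a b = trans (∙-distribʳ-⊕ p (a • q) (x ⊕ b • z)) (+-cong
    (trans (∙-distribˡ-⊕ p x (b • z)) (+-congˡ (∙-• b p z)))
    (trans (•-∙ a q (x ⊕ b • z)) (trans (*-congˡ (trans (∙-distribˡ-⊕ q x (b • z))
      (+-congˡ (∙-• b q z)))) (distribˡ a _ _))))

  sum-mono-≤ : {x y : V n} → (∀ i → x i ≤ y i) → sum x ≤ sum y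
  sum-mono-≤ {zero}  x≤y = ≤-refl
  sum-mono-≤ {suc n} x≤y = +-mono-≤ (x≤y zero) (sum-mono-≤ (x≤y ∘ suc))

  sum-nonNeg : {x : V n} → (∀ i → 0# ≤ x i) → 0# ≤ sum x
  sum-nonNeg {zero}  0≤x = ≤-refl
  sum-nonNeg {suc n} 0≤x = +-nonNeg (0≤x zero) (sum-nonNeg (0≤x ∘ suc))

  member≤sum : {x : V n} → (∀ i → 0# ≤ x i) → ∀ i → x i ≤ sum x
  member≤sum {x = x} 0≤x zero = ≤-from-difference (sum-nonNeg (0≤x ∘ suc))
    (solve 2 (λ x y → (x :+ y) :- x := y) refl (x zero) (sum (x ∘ suc)))
  member≤sum {x = x} 0≤x (suc i) = ≤-trans (member≤sum (0≤x ∘ suc) i) (≤-from-difference (0≤x zero)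
    (solve 2 (λ x y → (x :+ y) :- y := x) refl (x zero) (sum (x ∘ suc))))

  ∙-nonNeg : (x : V n) → 0# ≤ x ∙ x
  ∙-nonNeg x = sum-nonNeg λ i → square-nonNeg (x i)

  component²≤∙ : (x : V n) → ∀ i → x i * x i ≤ x ∙ x
  component²≤∙ x = member≤sum λ i → square-nonNeg (x i)

  ∙≈0⇒≋0 : {x : V n} → x ∙ x ≈ 0# → x ≋ 0v
  ∙≈0⇒≋0 {x = x} x∙x≈0 i = square≈0⇒≈0 (antisym
    (≤-respʳ (component²≤∙ x i) x∙x≈0) (square-nonNeg (x i)))

  ∙-positive : {x : V n} → Nontrivial x → Positive (x ∙ x)
  ∙-positive {x = x} (i , xi≉0) = ∙-nonNeg x , λ x∙x≈0 → xi≉0 (∙≈0⇒≋0 x∙x≈0 i)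

  ab≤a²+b² : ∀ a b → a * b ≤ a * a + b * b
  ab≤a²+b² a b = *-cancelˡ-≤ positive-2 (≤-from-difference
    (+-nonNeg (+-nonNeg (square-nonNeg a) (square-nonNeg b)) (square-nonNeg (a - b)))
    (solve 2 (λ a b → con (+ 2) :* (a :* a :+ b :* b) :- con (+ 2) :* (a :* b)
                    := (a :* a :+ b :* b) :+ (a :- b) :* (a :- b)) refl a b))

  Bounded : (V n → Carrier) → Set
  Bounded q = ∃[ K ] ∀ x → q x ≤ K * (x ∙ x)

  bounded-sum : {q : Fin m → V n → Carrier} → (∀ k → Bounded (q k)) → Bounded (λ x → ∑[ k < m ] q k x)
  bounded-sum {m} q-bounded = sum (proj₁ ∘ q-bounded) , λ x →
    ≤-respʳ (sum-mono-≤ λ k → proj₂ (q-bounded k) x)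
      (sym (*-distribʳ-sum {m} (x ∙ x) (proj₁ ∘ q-bounded)))

  bounded-monomial : ∀ i j a → Bounded {n} (λ x → x i * (x j * a))
  bounded-monomial i j a = 1# + a * a , λ x → begin
    x i * (x j * a)                            ≤⟨ ab≤a²+b² (x i) (x j * a) ⟩
    x i * x i + x j * a * (x j * a)            ≈⟨ +-congˡ (solve 2 (λ y a → y :* a :* (y :* a)
      := a :* a :* (y :* y)) refl (x j) a) ⟩
    x i * x i + a * a * (x j * x j)            ≤⟨ +-mono-≤ (component²≤∙ x i)
      (*-monoʳ-≤-nonNeg (square-nonNeg a) (component²≤∙ x j)) ⟩
    x ∙ x + a * a * (x ∙ x)                    ≈⟨ solve 2 (λ X a → X :+ a :* X
      := (con (+ 1) :+ a) :* X) refl (x ∙ x) (a * a) ⟩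
    (1# + a * a) * (x ∙ x)                     ∎

  -- Over coordinates the form is a finite sum of monomials `x k * (x i * w k i)`, each of which has
  -- its own bound.
  bounded-form : (w : Vector (V n) n) → Bounded (λ x → x ∙ lincomb x w)
  bounded-form {n} w = proj₁ bounded , λ x → ≤-trans
    (≤-reflexive (trans (∙-lincomb x x w) (sum-cong-≋ λ k → *-distribˡ-sum {n} (x k) _)))
    (proj₂ bounded x)
    where
    bounded = bounded-sum {m = n} (λ k → bounded-sum {m = n} (λ i → bounded-monomial {n} k i (w k i)))

  -- Eigenvalues of self-adjoint maps.

  SelfAdjoint : (V n → V n) → Set
  SelfAdjoint f = ∀ x y → f x ∙ y ≈ x ∙ f y

  Eigenvector : (V n → V n) → Carrier → V n → Set
  Eigenvector f ev v = Nontrivial v × f v ≋ ev • v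

  module _ {f : V n → V n} (f-linear : IsLinear f) (f-selfAdjoint : SelfAdjoint f) where
    open IsLinear f-linear

    -- If f has a right inverse z, the form of f dominates a multiple of
    -- the Euclidean one: expand f y ∙ y ≥ 0 at y = x - s z(x).
    coercive : (∀ x → 0# ≤ f x ∙ x) → (w : Vector (V n) n) → (∀ k → f (w k) ≋ unit k) →
               ∃[ s ] Positive s × (∀ x → s * (x ∙ x) ≤ f x ∙ x)
    coercive f-nonNeg w fw≋ = s , s>0 , bound
      where
      K₀ = proj₁ (bounded-form w)
      K = proj₁ (absoluteBound K₀)
      1≤K = proj₁ (proj₂ (absoluteBound K₀))
      K₀≤K = proj₁ (proj₂ (proj₂ (absoluteBound K₀)))

      K>0 : Positive K
      K>0 = ≤-trans 0≤1 1≤K , λ K≈0 → positive⇒≰0 positive-1 (≤-respʳ 1≤K K≈0)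

      s : Carrier
      s = proj₁ (inverse K (proj₂ K>0))

      Ks≈1 : K * s ≈ 1#
      Ks≈1 = proj₂ (inverse K (proj₂ K>0))

      s>0 : Positive s
      s>0 = positive-inverse K>0 Ks≈1

      -- With `F`, `X`, `Z` for `f x ∙ x`, `x ∙ x`, `x ∙ z`, positivity at `x - s z` gives
      -- `F - 2sX + s²Z ≥ 0`. Since `Z ≤ KX` and `s = 1/K`, also `s²Z ≤ sX`, and the two add up to
      -- `sX ≤ F`.
      identity : ∀ F X Z → F - s * X ≈ F + - s * X + (- s * X + - s * (- s * Z)) + (s * X - s * (s * Z))
      identity F X Z = solve 4 (λ s F X Z → F :- s :* X :=
        F :+ (:- s) :* X :+ ((:- s) :* X :+ (:- s) :* ((:- s) :* Z)) :+ (s :* X :- s :* (s :* Z))) refl s F X Z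

      algebra : ∀ {F X Z} → 0# ≤ F + - s * X + (- s * X + - s * (- s * Z)) → Z ≤ K * X → s * X ≤ F
      algebra {F} {X} {Z} 0≤ Z≤KX = ≤-from-difference
        (+-nonNeg 0≤ (x≤y⇒0≤y-x (*-monoʳ-≤-nonNeg (proj₁ s>0) (begin
          s * Z         ≤⟨ *-monoʳ-≤-nonNeg (proj₁ s>0) Z≤KX ⟩
          s * (K * X)   ≈⟨ solve 3 (λ s K X → s :* (K :* X) := K :* s :* X) refl s K X ⟩
          K * s * X     ≈⟨ *-congʳ Ks≈1 ⟩
          1# * X        ≈⟨ *-identityˡ X ⟩
          X             ∎))))
        (identity F X Z)

      bound : ∀ x → s * (x ∙ x) ≤ f x ∙ x
      bound x = algebra (≤-respʳ (f-nonNeg (x ⊕ (- s) • z)) (begin-equality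
          f (x ⊕ (- s) • z) ∙ (x ⊕ (- s) • z)
            ≈⟨ ∙-cong (λ i → trans (additive x ((- s) • z) i)
              (+-congˡ (homogeneous (- s) z i))) (λ _ → refl) ⟩
          (f x ⊕ (- s) • f z) ∙ (x ⊕ (- s) • z)
            ≈⟨ [p+aq]∙[x+bz] (f x) (f z) x z (- s) (- s) ⟩
          f x ∙ x + - s * (f x ∙ z) + (- s * (f z ∙ x) + - s * (- s * (f z ∙ z)))
            ≈⟨ +-cong (+-congˡ (*-congˡ (trans (f-selfAdjoint x z) (∙-cong (λ _ → refl) fz≋x))))
                      (+-cong (*-congˡ (∙-cong fz≋x (λ _ → refl))) (*-congˡ (*-congˡ
                        (∙-cong fz≋x (λ _ → refl))))) ⟩
          f x ∙ x + - s * (x ∙ x) + (- s * (x ∙ x) + - s * (- s * (x ∙ z))) ∎))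
        (≤-trans (proj₂ (bounded-form w) x) (≤-trans (≤-reflexive (*-comm _ _))
          (≤-trans (*-monoʳ-≤-nonNeg (∙-nonNeg x) K₀≤K) (≤-reflexive (*-comm _ _)))))
        where
        z : V n
        z = lincomb x w

        fz≋x : f z ≋ x
        fz≋x i = trans (lincomb-homo x w i)
          (trans (lincomb-cong {c = x} (λ _ → refl) fw≋ i) (lincomb-unit x i))

  module _ {f : V n → V n} (f-linear : IsLinear f) (f-selfAdjoint : SelfAdjoint f) where
    open IsLinear f-linear

    -- The sign is chosen so that the form of the shifted map is nonnegative once `ev` bounds the
    -- Rayleigh quotients.
    shift : Carrier → V n → V n
    shift ev x i = ev * x i - f x i

    shift-linear : ∀ ev → IsLinear (shift ev)
    shift-linear ev = record
      { cong = λ x≋y i → +-cong (*-congˡ (x≋y i)) (-‿cong (cong x≋y i))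
      ; additive = λ x y i → trans (+-congˡ (-‿cong (additive x y i)))
          (solve 5 (λ l x y p q → l :* (x :+ y) :- (p :+ q) := (l :* x :- p) :+ (l :* y :- q))
            refl ev (x i) (y i) (f x i) (f y i))
      ; homogeneous = λ a x i → trans (+-congˡ (-‿cong (homogeneous a x i)))
          (solve 4 (λ l a x p → l :* (a :* x) :- a :* p := a :* (l :* x :- p)) refl ev a (x i) (f x i))
      }

    shift-∙ : ∀ ev x y → shift ev x ∙ y ≈ ev * (x ∙ y) - f x ∙ y
    shift-∙ ev x y = begin-equality
      shift ev x ∙ y
        ≈⟨ ∙-cong (λ i → +-congˡ (solve 1 (λ a → :- a := (:- con (+ 1)) :* a)
          refl (f x i))) (λ _ → refl) ⟩
      (ev • x ⊕ (- 1#) • f x) ∙ y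
        ≈⟨ ∙-distribʳ-⊕ (ev • x) ((- 1#) • f x) y ⟩
      (ev • x) ∙ y + ((- 1#) • f x) ∙ y
        ≈⟨ +-cong (•-∙ ev x y) (trans (•-∙ (- 1#) (f x) y) (solve 1 (λ a → (:- con (+ 1)) :* a
          := :- a) refl (f x ∙ y))) ⟩
      ev * (x ∙ y) - f x ∙ y ∎

    shift-selfAdjoint : ∀ ev → SelfAdjoint (shift ev)
    shift-selfAdjoint ev x y = begin-equality
      shift ev x ∙ y              ≈⟨ shift-∙ ev x y ⟩
      ev * (x ∙ y) - f x ∙ y      ≈⟨ +-cong (*-congˡ (∙-comm x y)) (-‿cong
        (trans (f-selfAdjoint x y) (∙-comm x (f y)))) ⟩
      ev * (y ∙ x) - f y ∙ x      ≈⟨ shift-∙ ev y x ⟨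
      shift ev y ∙ x              ≈⟨ ∙-comm (shift ev y) x ⟩
      x ∙ shift ev y              ∎

    -- The numbers below some Rayleigh quotient, written without division. Taking everything below
    -- makes 0 a member as soon as the form has a positive value.
    RayleighBelow : Carrier → Set
    RayleighBelow t = ∃[ x ] Positive (x ∙ x) × t * (x ∙ x) ≤ f x ∙ x

    form-bounded : Bounded (λ x → f x ∙ x)
    form-bounded = proj₁ K , λ x → ≤-trans
      (≤-reflexive (trans (∙-comm (f x) x) (∙-cong (λ _ → refl) (expand x)))) (proj₂ K x)
      where
      K = bounded-form (f ∘ unit)

      expand : ∀ x → f x ≋ lincomb x (f ∘ unit)
      expand x i = trans (cong (λ i → sym (lincomb-unit x i)) i) (lincomb-homo x unit i)

    rayleigh-upperBound : ∀ {K} → (∀ x → f x ∙ x ≤ K * (x ∙ x)) → UpperBound RayleighBelow K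
    rayleigh-upperBound f≤K t (x , x∙x>0 , t≤) = *-cancelˡ-≤ x∙x>0
      (≤-trans (≤-reflexive (*-comm _ t)) (≤-trans t≤ (≤-respʳ (f≤K x) (*-comm _ _))))

    upperBound⇒form≤ : ∀ {ev} → UpperBound RayleighBelow ev → ∀ x → f x ∙ x ≤ ev * (x ∙ x)
    upperBound⇒form≤ {ev} ev-bound x with em {x ∙ x ≈ 0#}
    ... | yes x∙x≈0 = ≤-reflexive (trans (∙-zeroʳ (f x) (∙≈0⇒≋0 x∙x≈0)) (sym (trans
      (*-congˡ x∙x≈0) (zeroʳ ev))))
    ... | no  x∙x≉0 = begin
      f x ∙ x                ≈⟨ quotient ⟩
      x ∙ x * t              ≤⟨ *-monoʳ-≤-nonNeg (∙-nonNeg x) (ev-bound t t-below) ⟩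
      x ∙ x * ev             ≈⟨ *-comm _ _ ⟩
      ev * (x ∙ x)           ∎
      where
      i = proj₁ (inverse (x ∙ x) x∙x≉0)
      t = f x ∙ x * i

      quotient : f x ∙ x ≈ x ∙ x * t
      quotient = begin-equality
        f x ∙ x                ≈⟨ *-identityˡ _ ⟨
        1# * (f x ∙ x)         ≈⟨ *-congʳ (proj₂ (inverse (x ∙ x) x∙x≉0)) ⟨
        x ∙ x * i * (f x ∙ x)  ≈⟨ solve 3 (λ X i F → X :* i :* F := X :* (F :* i))
          refl (x ∙ x) i (f x ∙ x) ⟩
        x ∙ x * t              ∎

      t-below : RayleighBelow t
      t-below = x , (∙-nonNeg x , x∙x≉0) , ≤-reflexive (trans (*-comm t _) (sym quotient))

    module _ {ev} (ev-bound : UpperBound RayleighBelow ev)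
                  (ev-least : ∀ b → UpperBound RayleighBelow b → ev ≤ b) where

      ¬lower : ¬ (∃[ s ] Positive s × (∀ x → s * (x ∙ x) ≤ shift ev x ∙ x))
      ¬lower (s , s>0 , s≤) = positive⇒≰0 s>0 (0≤-x⇒x≤0 (≤-respʳ
        (x≤y⇒0≤y-x (ev-least (ev - s) (rayleigh-upperBound form≤ev-s)))
        (solve 2 (λ l s → (l :- s) :- l := :- s) refl ev s)))
        where
        form≤ev-s : ∀ x → f x ∙ x ≤ (ev - s) * (x ∙ x)
        form≤ev-s x = ≤-from-difference
          (x≤y⇒0≤y-x (≤-respʳ (s≤ x) (shift-∙ ev x x)))
          (solve 4 (λ l s X F → (l :- s) :* X :- F := (l :* X :- F) :- s :* X)
            refl ev s (x ∙ x) (f x ∙ x))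

      -- Otherwise ev - f is invertible, hence coercive, and the supremum
      -- of the Rayleigh quotients can be lowered.
      supremum-eigenvector : ∃[ v ] Eigenvector f ev v
      supremum-eigenvector with em {∃[ v ] Eigenvector f ev v}
      ... | yes p = p
      ... | no ¬p = contradiction
        (coercive (shift-linear ev) (shift-selfAdjoint ev)
          (λ x → ≤-respʳ (x≤y⇒0≤y-x (upperBound⇒form≤ ev-bound x)) (sym (shift-∙ ev x x)))
          (proj₁ ∘ preimage) (proj₂ ∘ preimage))
        ¬lower
        where
        injective : ∀ x → shift ev x ≋ 0v → x ≋ 0v
        injective x shift≋0 with nontrivial? x
        ... | inj₂ x≋0 = x≋0
        ... | inj₁ x≢0 = contradiction (x , x≢0 , λ i → sym (x-y≈0⇒x≈y (shift≋0 i))) ¬p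

        preimage : ∀ k → ∃[ x ] shift ev x ≋ unit k
        preimage k = injective⇒surjective (shift-linear ev) injective (unit k)

    -- The vector `x₀` puts 0 into the set, so the supremum is nonnegative; were it 0, the form
    -- would be at most 0 at `x₀`.
    positiveEigenvalue : ∀ {x₀} → Positive (f x₀ ∙ x₀) → ∃[ ev ] Positive ev × ∃[ v ] Eigenvector f ev v
    positiveEigenvalue {x₀} fx₀∙x₀>0 =
      let ev , ev-bound , ev-least = supremum RayleighBelow (0# , 0-below)
            (proj₁ form-bounded , rayleigh-upperBound (proj₂ form-bounded))
      in ev , (ev-bound 0# 0-below , ev≉0 ev-bound) , supremum-eigenvector ev-bound ev-least
      where
      x₀∙x₀>0 : Positive (x₀ ∙ x₀)
      x₀∙x₀>0 = ∙-nonNeg x₀ , λ x₀∙x₀≈0 → proj₂ fx₀∙x₀>0 (∙-zeroʳ (f x₀) (∙≈0⇒≋0 x₀∙x₀≈0))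

      0-below : RayleighBelow 0#
      0-below = x₀ , x₀∙x₀>0 , ≤-trans (≤-reflexive (zeroˡ _)) (proj₁ fx₀∙x₀>0)

      ev≉0 : ∀ {ev} → UpperBound RayleighBelow ev → ev ≉ 0#
      ev≉0 ev-bound ev≈0 = positive⇒≰0 fx₀∙x₀>0
        (≤-respʳ (upperBound⇒form≤ ev-bound x₀) (trans (*-congʳ ev≈0) (zeroˡ _)))

  module _ {f : V n → V n} (f-linear : IsLinear f) (f-selfAdjoint : SelfAdjoint f) where
    open IsLinear f-linear

    polarization : (∀ x → f x ∙ x ≈ 0#) → ∀ x y → f x ∙ y ≈ 0#
    polarization form≈0 x y = x*y≈0⇒y≈0 (proj₂ positive-2) (begin-equality
      (1# + 1#) * (f x ∙ y)
        ≈⟨ solve 1 (λ a → con (+ 2) :* a := con (+ 0) :+ a :+ (a :+ con (+ 0))) refl (f x ∙ y) ⟩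
      0# + f x ∙ y + (f x ∙ y + 0#)
        ≈⟨ +-cong (+-congʳ (form≈0 x)) (+-cong (trans (∙-comm (f y) x)
          (sym (f-selfAdjoint x y))) (form≈0 y)) ⟨
      f x ∙ x + f x ∙ y + (f y ∙ x + f y ∙ y)
        ≈⟨ +-cong (∙-distribˡ-⊕ (f x) x y) (∙-distribˡ-⊕ (f y) x y) ⟨
      f x ∙ (x ⊕ y) + f y ∙ (x ⊕ y)
        ≈⟨ ∙-distribʳ-⊕ (f x) (f y) (x ⊕ y) ⟨
      (f x ⊕ f y) ∙ (x ⊕ y)
        ≈⟨ ∙-cong (additive x y) (λ _ → refl) ⟨
      f (x ⊕ y) ∙ (x ⊕ y)
        ≈⟨ form≈0 (x ⊕ y) ⟩
      0# ∎)

    negated : V n → V n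
    negated x i = - f x i

    negated-linear : IsLinear negated
    negated-linear = record
      { cong = λ x≋y i → -‿cong (cong x≋y i)
      ; additive = λ x y i → trans (-‿cong (additive x y i))
          (solve 2 (λ p q → :- (p :+ q) := (:- p) :+ (:- q)) refl (f x i) (f y i))
      ; homogeneous = λ a x i → trans (-‿cong (homogeneous a x i))
          (solve 2 (λ a p → :- (a :* p) := a :* (:- p)) refl a (f x i))
      }

    negated-∙ : ∀ x y → negated x ∙ y ≈ - (f x ∙ y)
    negated-∙ x y = trans
      (∙-cong (λ i → solve 1 (λ a → :- a := (:- con (+ 1)) :* a) refl (f x i)) (λ _ → refl))
      (trans (•-∙ (- 1#) (f x) y) (solve 1 (λ a → (:- con (+ 1)) :* a := :- a) refl (f x ∙ y)))

    negated-selfAdjoint : SelfAdjoint negated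
    negated-selfAdjoint x y = begin-equality
      negated x ∙ y   ≈⟨ negated-∙ x y ⟩
      - (f x ∙ y)     ≈⟨ -‿cong (trans (f-selfAdjoint x y) (∙-comm x (f y))) ⟩
      - (f y ∙ x)     ≈⟨ negated-∙ y x ⟨
      negated y ∙ x   ≈⟨ ∙-comm (negated y) x ⟩
      x ∙ negated y   ∎

    -- By `polarization`, a form vanishing everywhere would give `f y ∙ f y ≈ 0#`.
    nonzeroForm : ∀ {y} → Nontrivial (f y) → ∃[ x ] f x ∙ x ≉ 0#
    nonzeroForm {y} fy≢0 with em {∃[ x ] f x ∙ x ≉ 0#}
    ... | yes p = p
    ... | no ¬p = contradiction (polarization form≈0 y (f y)) (proj₂ (∙-positive fy≢0))
      where
      form≈0 : ∀ x → f x ∙ x ≈ 0#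
      form≈0 x with em {f x ∙ x ≈ 0#}
      ... | yes q = q
      ... | no ¬q = contradiction (x , ¬q) ¬p

    -- The supremum detects positive values only. If the nonzero value of the form is negative, the
    -- argument is applied to `negated` and the sign of the eigenvalue reversed.
    nonzeroEigenvalue : ∀ {y} → Nontrivial (f y) → ∃[ ev ] ev ≉ 0# × ∃[ v ] Eigenvector f ev v
    nonzeroEigenvalue fy≢0 with nonzeroForm fy≢0
    ... | x , q≉0 with total 0# (f x ∙ x)
    ...   | inj₁ 0≤q = let ev , ev>0 , v , v-eigen = positiveEigenvalue f-linear f-selfAdjoint (0≤q , q≉0) in
      ev , proj₂ ev>0 , v , v-eigen
    ...   | inj₂ q≤0 =
      let ev , ev>0 , v , v≢0 , fv≋ = positiveEigenvalue negated-linear negated-selfAdjoint {x} -q>0 in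
      - ev , (λ -ev≈0 → proj₂ ev>0 (trans (solve 1 (λ a → a := :- (:- a)) refl ev)
        (trans (-‿cong -ev≈0) -0#≈0#))) ,
      v , v≢0 , λ i → trans (solve 1 (λ a → a := :- (:- a)) refl (f v i))
        (trans (-‿cong (fv≋ i)) (solve 2 (λ a b → :- (a :* b) := (:- a) :* b) refl ev (v i)))
      where
      -q>0 : Positive (negated x ∙ x)
      -q>0 = ≤-respʳ (x≤0⇒0≤-x q≤0) (sym (negated-∙ x x)) , λ -q≈0 → q≉0
        (trans (solve 1 (λ a → a := :- (:- a)) refl (f x ∙ x))
          (trans (-‿cong (trans (sym (negated-∙ x x)) -q≈0)) -0#≈0#))

-- The algebra of slices and its common eigenvectors.

module Algebras (em : ExcludedMiddle 0ℓ) (ℝ : CompleteOrderedField) where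
  open CompleteOrderedField ℝ hiding (zero)
  open Tensors ℝ
  open IntegerCoefficientSolver commutativeRing
  open OrderedField em ℝ
  open LinearAlgebra em ℝ
  open Spectral em ℝ
  open import Relation.Binary.Reasoning.Setoid setoid
  private variable
    m n : ℕ

  least : ∀ (P : ℕ → Set) k → P k → ∃[ m ] P m × (∀ j → P j → m ℕ.≤ j)
  least P = <-rec _ λ k recurse Pk → decide k recurse Pk em
    where
    decide : ∀ k → (∀ {j} → j ℕ.< k → P j → ∃[ m ] P m × (∀ j → P j → m ℕ.≤ j)) → P k →
             Dec (∃[ j ] j ℕ.< k × P j) → ∃[ m ] P m × (∀ j → P j → m ℕ.≤ j)
    decide k recurse Pk (yes (j , j<k , Pj)) = recurse j<k Pj
    decide k recurse Pk (no  none)           = k , Pk , λ j Pj → ℕ.≮⇒≥ λ j<k → none (j , j<k , Pj)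

  -- The algebra of a symmetric tensor S: x ∗ y is the contraction S(x, y, ·),
  -- and x ∗_ is the combination of slices with coefficients x.
  record SlicesAlgebra (n : ℕ) : Set where
    infixl 8 _∗_
    field
      _∗_           : V n → V n → V n
      ∗-linear      : ∀ x → IsLinear (x ∗_)
      ∗-comm        : ∀ x y → x ∗ y ≋ y ∗ x
      ∗-selfAdjoint : ∀ x → SelfAdjoint (x ∗_)
      ∗-commute     : ∀ x y z → x ∗ (y ∗ z) ≋ y ∗ (x ∗ z)

    ∗-congˡ : ∀ {x y z} → y ≋ z → x ∗ y ≋ x ∗ z
    ∗-congˡ {x} = IsLinear.cong (∗-linear x)

    ∗-distribˡ : ∀ x y z → x ∗ (y ⊕ z) ≋ x ∗ y ⊕ x ∗ z
    ∗-distribˡ x = IsLinear.additive (∗-linear x)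

    ∗-• : ∀ a x y → x ∗ (a • y) ≋ a • (x ∗ y)
    ∗-• a x = IsLinear.homogeneous (∗-linear x) a

    ∗-distribʳ : ∀ x y z → (x ⊕ y) ∗ z ≋ x ∗ z ⊕ y ∗ z
    ∗-distribʳ x y z i = trans (∗-comm (x ⊕ y) z i) (trans (∗-distribˡ z x y i)
      (+-cong (∗-comm z x i) (∗-comm z y i)))

    •-∗ : ∀ a x y → (a • x) ∗ y ≋ a • (x ∗ y)
    •-∗ a x y i = trans (∗-comm (a • x) y i) (trans (∗-• a y x i) (*-congˡ (∗-comm y x i)))

    -- In the presence of commutativity, associativity is the commutation of multiplications:
    -- `z (x y) = x (z y)`.
    ∗-assoc : ∀ x y z → (x ∗ y) ∗ z ≋ x ∗ (y ∗ z)
    ∗-assoc x y z i = trans (∗-comm (x ∗ y) z i) (trans (∗-commute z x y i) (∗-congˡ (∗-comm z y) i))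

  nontrivial-cong : {x y : V n} → x ≋ y → Nontrivial x → Nontrivial y
  nontrivial-cong x≋y (i , xi≉0) = i , λ yi≈0 → xi≉0 (trans (x≋y i) yi≈0)

  nontrivial-• : ∀ {a} {x : V n} → a ≉ 0# → Nontrivial x → Nontrivial (a • x)
  nontrivial-• a≉0 (i , xi≉0) = i , *-≉0 a≉0 xi≉0

  •-cancel : ∀ {a} {x y : V n} → a ≉ 0# → a • x ≋ a • y → x ≋ y
  •-cancel a≉0 ax≋ay i = *-cancelˡ-≉0 a≉0 (ax≋ay i)

  -- The vector `f v` lies in the image of `f` and is killed by `C`. Applying `C` to a relation
  -- between `f v` and the `f (x l)` leaves a relation between the independent `g (x l)`, after
  -- which only the coefficient of the nonzero `f v` remains.
  properFactor-rank< : {f g C : V n → V n} → IsLinear C → (∀ z → g z ≋ C (f z)) →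
    ∀ {v} → Nontrivial (f v) → g v ≋ 0v →
    ∀ {k} → IndependentImages g k → IndependentImages f (suc k)
  properFactor-rank< {f = f} {g} {C} C-linear g≋Cf {v} (i , fvᵢ≉0) gv≋0 {k} (x , x-independent) =
    (v ∷ x) , independent
    where
    open IsLinear C-linear

    independent : LinearlyIndependent (f ∘ (v ∷ x))
    independent c relation = λ where
        zero    → x*y≈0⇒y≈0 fvᵢ≉0 (begin
          f v i * c zero                                          ≈⟨ *-comm _ _ ⟩
          c zero * f v i                                          ≈⟨ +-identityʳ _ ⟨
          c zero * f v i + 0#                                     ≈⟨ +-congˡ (lincomb-zero {v = f ∘ x} tail≋0 i) ⟨
          c zero * f v i + lincomb (c ∘ suc) (f ∘ x) i            ≈⟨ relation i ⟩
          0#                                                      ∎)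
        (suc l) → tail≋0 l
      where
      tail≋0 : ∀ l → c (suc l) ≈ 0#
      tail≋0 = x-independent (c ∘ suc) λ j → begin
        lincomb (c ∘ suc) (g ∘ x) j                      ≈⟨ +-identityˡ _ ⟨
        0# + lincomb (c ∘ suc) (g ∘ x) j                 ≈⟨ +-congʳ (trans
          (*-congˡ (gv≋0 j)) (zeroʳ _)) ⟨
        c zero * g v j + lincomb (c ∘ suc) (g ∘ x) j     ≈⟨ lincomb-cong {c = c} (λ _ →
          refl) (λ l → g≋Cf ((v ∷ x) l)) j ⟩
        lincomb c (C ∘ f ∘ (v ∷ x)) j                    ≈⟨ lincomb-homo c (f ∘ (v ∷ x)) j ⟨
        C (lincomb c (f ∘ (v ∷ x))) j                    ≈⟨ cong relation j ⟩
        C 0v j                                           ≈⟨ zero-homo j ⟩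
        0#                                               ∎

  module CommonEigenvector (A : SlicesAlgebra n) where
    open SlicesAlgebra A

    Nonzero : V n → Set
    Nonzero x = ∃[ z ] Nontrivial (x ∗ z)

    nonzero? : ∀ x → Nonzero x ⊎ (∀ z → x ∗ z ≋ 0v)
    nonzero? x with em {Nonzero x}
    ... | yes p = inj₁ p
    ... | no ¬p = inj₂ λ z → [ (λ xz≢0 → contradiction (z , xz≢0) ¬p) , (λ xz≋0 →
      xz≋0) ]′ (nontrivial? (x ∗ z))

    -- Minimality of the rank is used only through this consequence: such a `y ∗_` has smaller rank
    -- than `x ∗_`, so it must vanish.
    Minimal : V n → Set
    Minimal x = ∀ y {C} → IsLinear C → (∀ z → y ∗ z ≋ C (x ∗ z)) →
                ∀ {v} → Nontrivial (x ∗ v) → y ∗ v ≋ 0v → ∀ z → y ∗ z ≋ 0v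

    minimal : ∀ {x₀} → Nonzero x₀ → ∃[ x ] Nonzero x × Minimal x
    minimal {x₀} x₀-nonzero = fromLeast (least RankBelow (suc n) (x₀ , x₀-nonzero , ¬full))
      where
      -- "Some nonzero multiplication has rank less than `k`": the least such `k` is one more than
      -- the minimal rank, so it cannot be 0.
      RankBelow : ℕ → Set
      RankBelow k = ∃[ x ] Nonzero x × ¬ IndependentImages (x ∗_) k

      ¬full : ¬ IndependentImages (x₀ ∗_) (suc n)
      ¬full (x , x-independent) = contradiction
        (independent⇒≤ x-independent (λ l → x₀ ∗ x l , λ i → sym (lincomb-unit (x₀ ∗ x l) i))) ℕ.1+n≰n

      fromLeast : (∃[ m ] RankBelow m × (∀ j → RankBelow j → m ℕ.≤ j)) → ∃[ x ] Nonzero x × Minimal x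
      fromLeast (zero , (x , _ , ¬independent) , _) = contradiction ((λ ()) , λ _ _ ()) ¬independent
      fromLeast (suc k , (x , x-nonzero , ¬independent) , k-least) = x , x-nonzero ,
        λ y C-linear y≋Cx xv≢0 yv≋0 → [ (λ y-nonzero → contradiction
            (k-least k (y , y-nonzero , λ y-independent →
              ¬independent (properFactor-rank< C-linear y≋Cx xv≢0 yv≋0 y-independent)))
            ℕ.1+n≰n) , (λ y≋0 → y≋0) ]′ (nonzero? y)

    -- The element x ∗ y - ev x of the algebra acts by zero, being a proper
    -- factor of x.
    scalar-extends : ∀ {x} → Minimal x → ∀ {y ev v} → Nontrivial (x ∗ v) →
                     y ∗ (x ∗ v) ≋ ev • (x ∗ v) → ∀ z → y ∗ (x ∗ z) ≋ ev • (x ∗ z)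
    scalar-extends {x} x-minimal {y} {ev} {v} xv≢0 eigen z i =
      x-y≈0⇒x≈y (trans (sym (shifted z i)) (x-minimal t C-linear shifted xv≢0 tv≋0 z i))
      where
      t : V n
      t = x ∗ y ⊕ (- ev) • x

      C : V n → V n
      C u i = (y ∗ u) i - ev * u i

      C-linear : IsLinear C
      C-linear = record
        { cong = λ x≋y i → +-cong (∗-congˡ x≋y i) (-‿cong (*-congˡ (x≋y i)))
        ; additive = λ p q i → trans (+-congʳ (∗-distribˡ y p q i))
            (solve 5 (λ l p q yp yq → (yp :+ yq) :- l :* (p :+ q)
              := (yp :- l :* p) :+ (yq :- l :* q)) refl ev (p i) (q i) ((y ∗ p) i) ((y ∗ q) i))
        ; homogeneous = λ a p i → trans (+-congʳ (∗-• a y p i))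
            (solve 4 (λ l a p yp → a :* yp :- l :* (a :* p) := a :* (yp :- l :* p))
              refl ev a (p i) ((y ∗ p) i))
        }

      shifted : ∀ z → t ∗ z ≋ C (x ∗ z)
      shifted z i = begin
        (t ∗ z) i
          ≈⟨ ∗-distribʳ (x ∗ y) ((- ev) • x) z i ⟩
        (x ∗ y ∗ z) i + (((- ev) • x) ∗ z) i
          ≈⟨ +-cong (trans (∗-assoc x y z i) (∗-commute x y z i)) (•-∗ (- ev) x z i) ⟩
        (y ∗ (x ∗ z)) i + - ev * (x ∗ z) i
          ≈⟨ +-congˡ (solve 2 (λ l p → (:- l) :* p := :- (l :* p)) refl ev ((x ∗ z) i)) ⟩
        (y ∗ (x ∗ z)) i - ev * (x ∗ z) i ∎

      tv≋0 : t ∗ v ≋ 0v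
      tv≋0 i = trans (shifted v i) (trans (+-congʳ (eigen i)) (-‿inverseʳ _))

    module _ {x} (x-minimal : Minimal x) {ev} (ev≉0 : ev ≉ 0#) {w} (w≢0 : Nontrivial w) (xw≋ : x ∗ w ≋ ev • w) where

      xw≢0 : Nontrivial (x ∗ w)
      xw≢0 = nontrivial-cong (λ i → sym (xw≋ i)) (nontrivial-• ev≉0 w≢0)

      -- Up to the factor `ev`, the multiplication by `x` is a projection: on `x ∗ w`, a multiple of
      -- `w`, it acts as `ev`, and minimality extends this to its whole image.
      idempotent : ∀ z → x ∗ (x ∗ z) ≋ ev • (x ∗ z)
      idempotent = scalar-extends x-minimal xw≢0 (λ i → trans (∗-congˡ xw≋ i) (∗-• ev x w i))

      -- As `ν` is nonzero, `v` is a multiple of `x ∗ (y ∗ v)` and thus lies in the image of `x ∗_`,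
      -- where `x` acts as `ev`. Hence `y` acts on `x ∗ v` as `ν / ev`, and minimality extends this
      -- scalar.
      scalar-from-eigenvector : ∀ {y ν v} → ν ≉ 0# → Nontrivial v → x ∗ y ∗ v ≋ ν • v →
                                ∃[ c ] ∀ z → y ∗ (x ∗ z) ≋ c • (x ∗ z)
      scalar-from-eigenvector {y} {ν} {v} ν≉0 v≢0 xyv≋ = ν * i , scalar-extends x-minimal
          (nontrivial-cong (λ j → sym (xv≋ j)) (nontrivial-• ev≉0 v≢0))
          (λ j → begin
            (y ∗ (x ∗ v)) j           ≈⟨ ∗-commute y x v j ⟩
            (x ∗ (y ∗ v)) j           ≈⟨ xyv≋′ j ⟩
            ν * v j                   ≈⟨ *-congˡ (trans (sym (*-identityˡ _)) (*-congʳ (sym ev*i≈1))) ⟩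
            ν * (ev * i * v j)        ≈⟨ solve 4 (λ ν e i v → ν :* (e :* i :* v)
              := ν :* i :* (e :* v)) refl ν ev i (v j) ⟩
            ν * i * (ev * v j)        ≈⟨ *-congˡ (sym (xv≋ j)) ⟩
            ν * i * (x ∗ v) j         ∎)
        where
        i = proj₁ (inverse ev ev≉0)
        ev*i≈1 = proj₂ (inverse ev ev≉0)

        xyv≋′ : x ∗ (y ∗ v) ≋ ν • v
        xyv≋′ j = trans (sym (∗-assoc x y v j)) (xyv≋ j)

        xv≋ : x ∗ v ≋ ev • v
        xv≋ = •-cancel ν≉0 λ j → begin
          ν * (x ∗ v) j              ≈⟨ ∗-• ν x v j ⟨
          (x ∗ (ν • v)) j            ≈⟨ ∗-congˡ xyv≋′ j ⟨
          (x ∗ (x ∗ (y ∗ v))) j      ≈⟨ idempotent (y ∗ v) j ⟩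
          ev * (x ∗ (y ∗ v)) j       ≈⟨ *-congˡ (xyv≋′ j) ⟩
          ev * (ν * v j)             ≈⟨ solve 3 (λ e ν v → e :* (ν :* v) := ν :* (e :* v))
            refl ev ν (v j) ⟩
          ν * (ev * v j)             ∎

      -- The eigenvector is taken for `x ∗ y` rather than for `y`: a nonzero eigenvalue there places
      -- it in the image of `x ∗_`. If `x ∗ y` acts by zero, the scalar is 0.
      scalar : ∀ y → ∃[ c ] ∀ z → y ∗ (x ∗ z) ≋ c • (x ∗ z)
      scalar y = [ fromNonzero , fromZero ]′ (nonzero? (x ∗ y))
        where
        fromNonzero : Nonzero (x ∗ y) → ∃[ c ] ∀ z → y ∗ (x ∗ z) ≋ c • (x ∗ z)
        fromNonzero (z , xyz≢0) =
          let ν , ν≉0 , v , v≢0 , xyv≋ = nonzeroEigenvalue (∗-linear (x ∗ y)) (∗-selfAdjoint (x ∗ y)) {z} xyz≢0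
          in scalar-from-eigenvector ν≉0 v≢0 xyv≋

        fromZero : (∀ z → x ∗ y ∗ z ≋ 0v) → ∃[ c ] ∀ z → y ∗ (x ∗ z) ≋ c • (x ∗ z)
        fromZero xy≋0 = 0# , λ z i → trans (∗-commute y x z i)
          (trans (sym (∗-assoc x y z i)) (trans (xy≋0 z i) (sym (zeroˡ _))))

      eigenvector-of-all : ∀ y → ∃[ c ] y ∗ w ≋ c • w
      eigenvector-of-all y = let c , scalar-c = scalar y in c , •-cancel ev≉0 λ i → begin
        ev * (y ∗ w) i       ≈⟨ ∗-• ev y w i ⟨
        (y ∗ (ev • w)) i     ≈⟨ ∗-congˡ xw≋ i ⟨
        (y ∗ (x ∗ w)) i      ≈⟨ scalar-c w i ⟩
        c * (x ∗ w) i        ≈⟨ *-congˡ (xw≋ i) ⟩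
        c * (ev * w i)       ≈⟨ solve 3 (λ c e w → c :* (e :* w) := e :* (c :* w)) refl c ev (w i) ⟩
        ev * (c * w i)       ∎

    -- Contracting `κ w ⊗ w ⊗ w` with `y` and `w` gives exactly this multiple of `w`, so `κ` is the
    -- coefficient of the term to be split off.
    IsCommonEigenvector : V n → Carrier → Set
    IsCommonEigenvector w κ = ∀ y → y ∗ w ≋ (κ * (w ∙ w) * (y ∙ w)) • w

    -- By invariance, c (w ∙ w) = (y ∗ w) ∙ w = y ∙ (w ∗ w) is proportional to y ∙ w.
    common-eigenvalues : ∀ {w} → Nontrivial w → (∀ y → ∃[ c ] y ∗ w ≋ c • w) →
      ∃[ κ ] IsCommonEigenvector w κ
    common-eigenvalues {w} w≢0 eigen = ν * i * i , λ y j → let c , yw≋cw = eigen y in begin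
        (y ∗ w) j                              ≈⟨ yw≋cw j ⟩
        c * w j                                ≈⟨ *-congʳ (value y c yw≋cw) ⟩
        ν * i * (y ∙ w) * w j                  ≈⟨ *-congʳ (*-congʳ (trans (sym
          (*-identityʳ _)) (*-congˡ (sym ωi≈1)))) ⟩
        ν * i * (w ∙ w * i) * (y ∙ w) * w j    ≈⟨ *-congʳ (*-congʳ
          (solve 3 (λ ν i ω → ν :* i :* (ω :* i) := ν :* i :* i :* ω) refl ν i (w ∙ w))) ⟩
        ν * i * i * (w ∙ w) * (y ∙ w) * w j    ∎
      where
      ν = proj₁ (eigen w)
      ω≉0 = proj₂ (∙-positive w≢0)
      i = proj₁ (inverse (w ∙ w) ω≉0)
      ωi≈1 = proj₂ (inverse (w ∙ w) ω≉0)

      value : ∀ y c → y ∗ w ≋ c • w → c ≈ ν * i * (y ∙ w)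
      value y c yw≋cw = begin
        c                          ≈⟨ trans (sym (*-identityʳ c)) (*-congˡ (sym ωi≈1)) ⟩
        c * (w ∙ w * i)            ≈⟨ *-assoc _ _ _ ⟨
        c * (w ∙ w) * i            ≈⟨ *-congʳ (•-∙ c w w) ⟨
        (c • w) ∙ w * i            ≈⟨ *-congʳ (∙-cong yw≋cw (λ _ → refl)) ⟨
        (y ∗ w) ∙ w * i            ≈⟨ *-congʳ (∙-cong (∗-comm y w) (λ _ → refl)) ⟩
        (w ∗ y) ∙ w * i            ≈⟨ *-congʳ (∗-selfAdjoint w y w) ⟩
        y ∙ (w ∗ w) * i            ≈⟨ *-congʳ (∙-cong (λ _ → refl) (proj₂ (eigen w))) ⟩
        y ∙ (ν • w) * i            ≈⟨ *-congʳ (∙-• ν y w) ⟩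
        ν * (y ∙ w) * i            ≈⟨ solve 3 (λ ν Y i → ν :* Y :* i := ν :* i :* Y) refl ν (y ∙ w) i ⟩
        ν * i * (y ∙ w)            ∎

    commonEigenvector : ∀ {x₀} → Nonzero x₀ →
      ∃[ w ] Nontrivial w × ∃[ κ ] κ ≉ 0# × IsCommonEigenvector w κ
    commonEigenvector x₀-nonzero =
      let x , (z , xz≢0) , x-minimal = minimal x₀-nonzero
          ev , ev≉0 , w , w≢0 , xw≋ = nonzeroEigenvalue (∗-linear x) (∗-selfAdjoint x) {z} xz≢0
          κ , w-common = common-eigenvalues w≢0 (eigenvector-of-all x-minimal ev≉0 w≢0 xw≋)
      in w , w≢0 , κ , nonzero ev≉0 w≢0 xw≋ w-common , w-common
      where
      -- With `κ` zero every multiplication would kill `w`, contrary to `x ∗ w ≋ ev • w`. A nonzero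
      -- `κ` is what makes the deflation lower the rank.
      nonzero : ∀ {x w ev κ} → ev ≉ 0# → Nontrivial w → x ∗ w ≋ ev • w → IsCommonEigenvector w κ →
        κ ≉ 0#
      nonzero {x} {w} ev≉0 w≢0 xw≋ w-common κ≈0 =
        let j , evw≉0 = nontrivial-• ev≉0 w≢0 in evw≉0 (trans (sym (xw≋ j)) (trans (w-common x j)
          (trans (*-congʳ (trans (*-congʳ (trans (*-congʳ κ≈0) (zeroˡ _))) (zeroˡ _))) (zeroˡ _))))

-- Splitting off a common eigenvector.

module Decomposition (em : ExcludedMiddle 0ℓ) (ℝ : CompleteOrderedField) where
  open CompleteOrderedField ℝ hiding (zero)
  open Tensors ℝ
  open IntegerCoefficientSolver commutativeRing
  open OrderedField em ℝ
  open LinearAlgebra em ℝ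
  open Spectral em ℝ
  open Algebras em ℝ
  open import Relation.Binary.Reasoning.Setoid setoid
  private variable
    m n : ℕ

  module Deflation (A : SlicesAlgebra n) {w : V n} (w≢0 : Nontrivial w) {κ} (κ≉0 : κ ≉ 0#)
                   (w-common : CommonEigenvector.IsCommonEigenvector A w κ) where
    open SlicesAlgebra A

    private
      ω : Carrier
      ω = w ∙ w

      ω≉0 : ω ≉ 0#
      ω≉0 = proj₂ (∙-positive w≢0)

      ω⁻¹ : Carrier
      ω⁻¹ = proj₁ (inverse ω ω≉0)

      ωω⁻¹≈1 : ω * ω⁻¹ ≈ 1#
      ωω⁻¹≈1 = proj₂ (inverse ω ω≉0)

    infixl 8 _∗′_
    -- The product belonging to the tensor minus `κ w ⊗ w ⊗ w`.
    _∗′_ : V n → V n → V n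
    x ∗′ y = x ∗ y ⊕ (- (κ * (x ∙ w) * (y ∙ w))) • w

    ∗′-linear : ∀ x → IsLinear (x ∗′_)
    ∗′-linear x = record
      { cong = λ y≋z i → +-cong (∗-congˡ y≋z i) (*-congʳ (-‿cong (*-congˡ (∙-cong y≋z (λ _ → refl)))))
      ; additive = λ y z i → trans
          (+-cong (∗-distribˡ x y z i) (*-congʳ (-‿cong (*-congˡ (∙-distribʳ-⊕ y z w)))))
          (solve 6 (λ p q k b c w → (p :+ q) :+ (:- (k :* (b :+ c))) :* w
            := (p :+ (:- (k :* b)) :* w) :+ (q :+ (:- (k :* c)) :* w))
            refl ((x ∗ y) i) ((x ∗ z) i) (κ * (x ∙ w)) (y ∙ w) (z ∙ w) (w i))
      ; homogeneous = λ a y i → trans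
          (+-cong (∗-• a x y i) (*-congʳ (-‿cong (*-congˡ (•-∙ a y w)))))
          (solve 5 (λ a p k b w → a :* p :+ (:- (k :* (a :* b))) :* w := a :* (p :+ (:- (k :* b)) :* w))
            refl a ((x ∗ y) i) (κ * (x ∙ w)) (y ∙ w) (w i))
      }

    ∗′-comm : ∀ x y → x ∗′ y ≋ y ∗′ x
    ∗′-comm x y i = +-cong (∗-comm x y i) (*-congʳ (-‿cong
      (solve 3 (λ k a b → k :* a :* b := k :* b :* a) refl κ (x ∙ w) (y ∙ w))))

    ∗′-∙ : ∀ x y z → (x ∗′ y) ∙ z ≈ (x ∗ y) ∙ z + - (κ * (x ∙ w) * (y ∙ w)) * (w ∙ z)
    ∗′-∙ x y z = trans (∙-distribʳ-⊕ (x ∗ y) _ z) (+-congˡ (•-∙ _ w z))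

    ∗′-selfAdjoint : ∀ x → SelfAdjoint (x ∗′_)
    ∗′-selfAdjoint x y z = begin
      (x ∗′ y) ∙ z
        ≈⟨ ∗′-∙ x y z ⟩
      (x ∗ y) ∙ z + - (κ * (x ∙ w) * (y ∙ w)) * (w ∙ z)
        ≈⟨ +-cong (trans (∗-selfAdjoint x y z) (∙-comm y (x ∗ z)))
             (trans (*-congˡ (∙-comm w z)) (trans (solve 3 (λ k b c → (:- (k :* b)) :* c
               := (:- (k :* c)) :* b) refl (κ * (x ∙ w)) (y ∙ w) (z ∙ w))
               (*-congˡ (∙-comm y w)))) ⟩
      (x ∗ z) ∙ y + - (κ * (x ∙ w) * (z ∙ w)) * (w ∙ y)
        ≈⟨ ∗′-∙ x z y ⟨
      (x ∗′ z) ∙ y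
        ≈⟨ ∙-comm (x ∗′ z) y ⟩
      y ∙ (x ∗′ z) ∎

    ∗′-w : ∀ x → x ∗′ w ≋ 0v
    ∗′-w x i = trans (+-congʳ (w-common x i))
      (solve 4 (λ k o a w → k :* o :* a :* w :+ (:- (k :* a :* o)) :* w := con (+ 0))
        refl κ ω (x ∙ w) (w i))

    -- Self-adjointness moves the multiplication over to `w`, which it kills.
    ∗′-⊥w : ∀ x y → (x ∗′ y) ∙ w ≈ 0#
    ∗′-⊥w x y = trans (∗′-selfAdjoint x y w) (∙-zeroʳ y (∗′-w x))

    -- The outer correction vanishes because `y ∗′ z` is orthogonal to `w`; the inner one that
    -- survives is symmetric in `x` and `y`, which gives `∗′-commute`.
    ∗′-∗′ : ∀ x y z → x ∗′ (y ∗′ z) ≋ x ∗ (y ∗ z) ⊕ (- (κ * (y ∙ w) * (z ∙ w)) * (κ * ω * (x ∙ w))) • w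
    ∗′-∗′ x y z i = begin
      (x ∗ (y ∗′ z)) i + - (κ * (x ∙ w) * ((y ∗′ z) ∙ w)) * w i
        ≈⟨ +-congˡ (*-congʳ (-‿cong (trans (*-congˡ (∗′-⊥w y z)) (zeroʳ _)))) ⟩
      (x ∗ (y ∗′ z)) i + - 0# * w i
        ≈⟨ solve 2 (λ p w → p :+ (:- con (+ 0)) :* w := p) refl ((x ∗ (y ∗′ z)) i) (w i) ⟩
      (x ∗ (y ∗′ z)) i
        ≈⟨ ∗-distribˡ x (y ∗ z) (c • w) i ⟩
      (x ∗ (y ∗ z)) i + (x ∗ (c • w)) i
        ≈⟨ +-congˡ (trans (∗-• c x w i) (trans (*-congˡ (w-common x i)) (sym (*-assoc _ _ _)))) ⟩
      (x ∗ (y ∗ z)) i + c * (κ * ω * (x ∙ w)) * w i ∎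
      where
      c : Carrier
      c = - (κ * (y ∙ w) * (z ∙ w))

    ∗′-commute : ∀ x y z → x ∗′ (y ∗′ z) ≋ y ∗′ (x ∗′ z)
    ∗′-commute x y z i = trans (∗′-∗′ x y z i) (trans
      (+-cong (∗-commute x y z i) (*-congʳ (solve 5 (λ k o a b c →
        (:- (k :* b :* c)) :* (k :* o :* a) := (:- (k :* a :* c)) :* (k :* o :* b))
          refl κ ω (x ∙ w) (y ∙ w) (z ∙ w))))
      (sym (∗′-∗′ y x z i)))

    deflated : SlicesAlgebra n
    deflated = record
      { _∗_           = _∗′_
      ; ∗-linear      = ∗′-linear
      ; ∗-comm        = ∗′-comm
      ; ∗-selfAdjoint = ∗′-selfAdjoint
      ; ∗-commute     = ∗′-commute
      }

    raised : V n → V n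
    raised c = c ⊕ (1# - c ∙ w * ω⁻¹) • w

    -- The component of c along w is replaced by w itself, whose slice is
    -- nonzero and maps into the line of w.
    raised-∗ : ∀ c z → raised c ∗ z ≋ c ∗′ z ⊕ (κ * ω * (z ∙ w)) • w
    raised-∗ c z i = begin
      (raised c ∗ z) i
        ≈⟨ ∗-distribʳ c _ z i ⟩
      (c ∗ z) i + (((1# - c ∙ w * ω⁻¹) • w) ∗ z) i
        ≈⟨ +-congˡ (trans (•-∗ _ w z i) (*-congˡ (trans (∗-comm w z i) (w-common z i)))) ⟩
      (c ∗ z) i + (1# - c ∙ w * ω⁻¹) * (κ * ω * (z ∙ w) * w i)
        ≈⟨ +-congˡ (solve 6 (λ g j k o b w →
             (con (+ 1) :- g :* j) :* (k :* o :* b :* w)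
               := k :* o :* b :* w :- k :* g :* b :* w :* (o :* j))
             refl (c ∙ w) ω⁻¹ κ ω (z ∙ w) (w i)) ⟩
      (c ∗ z) i + (κ * ω * (z ∙ w) * w i - κ * (c ∙ w) * (z ∙ w) * w i * (ω * ω⁻¹))
        ≈⟨ +-congˡ (+-congˡ (-‿cong (trans (*-congˡ ωω⁻¹≈1) (*-identityʳ _)))) ⟩
      (c ∗ z) i + (κ * ω * (z ∙ w) * w i - κ * (c ∙ w) * (z ∙ w) * w i)
        ≈⟨ solve 4 (λ p q r w → p :+ (q :- r :* w) := p :+ (:- r) :* w :+ q)
          refl ((c ∗ z) i) (κ * ω * (z ∙ w) * w i) (κ * (c ∙ w) * (z ∙ w)) (w i) ⟩
      (c ∗′ z) i + κ * ω * (z ∙ w) * w i ∎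

    project : V n → V n
    project x = x ⊕ (- (x ∙ w * ω⁻¹)) • w

    project-∙ : ∀ x → project x ∙ w ≈ 0#
    project-∙ x = begin
      project x ∙ w                         ≈⟨ ∙-distribʳ-⊕ x _ w ⟩
      x ∙ w + ((- (x ∙ w * ω⁻¹)) • w) ∙ w   ≈⟨ +-congˡ (•-∙ _ w w) ⟩
      x ∙ w + - (x ∙ w * ω⁻¹) * ω           ≈⟨ solve 3 (λ a j o → a :+ (:- (a :* j)) :* o
        := a :- a :* (o :* j)) refl (x ∙ w) ω⁻¹ ω ⟩
      x ∙ w - x ∙ w * (ω * ω⁻¹)             ≈⟨ +-congˡ (-‿cong (trans (*-congˡ ωω⁻¹≈1)
        (*-identityʳ _))) ⟩
      x ∙ w - x ∙ w                         ≈⟨ -‿inverseʳ _ ⟩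
      0#                                    ∎

    raised-project : ∀ c x → raised c ∗ project x ≋ c ∗′ x
    raised-project c x i = begin
      (raised c ∗ project x) i
        ≈⟨ raised-∗ c (project x) i ⟩
      (c ∗′ project x) i + κ * ω * (project x ∙ w) * w i
        ≈⟨ +-cong (IsLinear.additive (∗′-linear c) x _ i) (*-congʳ (trans
          (*-congˡ (project-∙ x)) (zeroʳ _))) ⟩
      (c ∗′ x) i + (c ∗′ ((- (x ∙ w * ω⁻¹)) • w)) i + 0# * w i
        ≈⟨ +-cong (+-congˡ (trans (IsLinear.homogeneous (∗′-linear c) _ w i) (trans
          (*-congˡ (∗′-w c i)) (zeroʳ _)))) (zeroˡ _) ⟩
      (c ∗′ x) i + 0# + 0#
        ≈⟨ trans (+-identityʳ _) (+-identityʳ _) ⟩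
      (c ∗′ x) i ∎

    raised-w : ∀ c → raised c ∗ w ≋ (κ * ω * ω) • w
    raised-w c i = trans (raised-∗ c w i) (trans (+-congʳ (∗′-w c i)) (+-identityˡ _))

    -- The additional argument is `w`, whose image is a nonzero multiple of `w`. The old arguments,
    -- projected off `w`, keep their deflated images, which are orthogonal to `w`. Pairing a
    -- relation with `w` therefore isolates its first coefficient.
    independentImages-raised : ∀ {c k} → IndependentImages (c ∗′_) k →
      IndependentImages (raised c ∗_) (suc k)
    independentImages-raised {c} {k} (x , x-independent) = v , independent
      where
      v : Vector (V n) (suc k)
      v = w ∷ project ∘ x

      module _ (d : V (suc k)) (relation : ∀ i → lincomb d ((raised c ∗_) ∘ v) i ≈ 0#) where
        d₀≈0 : d zero ≈ 0#
        d₀≈0 = x*y≈0⇒y≈0 (*-≉0 (*-≉0 (*-≉0 κ≉0 ω≉0) ω≉0) ω≉0) (begin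
          κ * ω * ω * ω * d zero
            ≈⟨ *-comm _ _ ⟩
          d zero * (κ * ω * ω * ω)
            ≈⟨ *-congˡ (trans (∙-cong (λ _ → refl) (raised-w c)) (∙-• (κ * ω * ω) w w)) ⟨
          d zero * (w ∙ (raised c ∗ w))
            ≈⟨ +-identityʳ _ ⟨
          d zero * (w ∙ (raised c ∗ w)) + 0#
            ≈⟨ +-congˡ (sum-zero {k} λ l → trans (*-congˡ (trans (∙-comm w _)
                 (trans (∙-cong (raised-project c (x l)) (λ _ → refl)) (∗′-⊥w c (x l))))) (zeroʳ _)) ⟨
          (∑[ l < suc k ] (d l * (w ∙ (raised c ∗ v l))))
            ≈⟨ ∙-lincomb w d ((raised c ∗_) ∘ v) ⟨
          w ∙ lincomb d ((raised c ∗_) ∘ v)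
            ≈⟨ ∙-zeroʳ w relation ⟩
          0# ∎)

        tail-relation : ∀ i → lincomb (d ∘ suc) ((c ∗′_) ∘ x) i ≈ 0#
        tail-relation i = begin
          lincomb (d ∘ suc) ((c ∗′_) ∘ x) i
            ≈⟨ lincomb-cong {c = d ∘ suc} (λ _ → refl) (λ l → raised-project c (x l)) i ⟨
          lincomb (d ∘ suc) ((raised c ∗_) ∘ project ∘ x) i
            ≈⟨ +-identityˡ _ ⟨
          0# + lincomb (d ∘ suc) ((raised c ∗_) ∘ project ∘ x) i
            ≈⟨ +-congʳ (trans (*-congʳ d₀≈0) (zeroˡ _)) ⟨
          lincomb d ((raised c ∗_) ∘ v) i
            ≈⟨ relation i ⟩
          0# ∎

      independent : LinearlyIndependent ((raised c ∗_) ∘ v)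
      independent d relation zero    = d₀≈0 d relation
      independent d relation (suc l) = x-independent (d ∘ suc) (tail-relation d relation) l

  -- A sum of cubes as a trilinear form: unlike an identity of entries it passes through deflation
  -- free of coordinates, and its values at unit vectors give the entries back.
  CubeSum : SlicesAlgebra n → ℕ → Set
  CubeSum {n} A r = Σ[ u ∈ Vector (V n) r ] ∀ x y z →
    (x ∗ y) ∙ z ≈ ∑[ l < r ] (u l ∙ x * (u l ∙ y) * (u l ∙ z))
    where open SlicesAlgebra A

  cubeSum-zero : (A : SlicesAlgebra n) → (∀ x y → SlicesAlgebra._∗_ A x y ≋ 0v) → ∀ r → CubeSum A r
  cubeSum-zero A A≋0 r = (λ _ → 0v) , λ x y z → trans
    (trans (∙-comm _ z) (∙-zeroʳ z (A≋0 x y)))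
    (sym (sum-zero {r} λ l → trans (*-congʳ (trans (*-congʳ
      (trans (∙-comm 0v x) (∙-zeroʳ x (λ _ → refl)))) (zeroˡ _))) (zeroˡ _)))

  module _ (A : SlicesAlgebra n) {w : V n} (w≢0 : Nontrivial w) {κ} (κ≉0 : κ ≉ 0#)
           (w-common : CommonEigenvector.IsCommonEigenvector A w κ) where
    open SlicesAlgebra A
    open Deflation A w≢0 κ≉0 w-common

    cubeSum-deflated : ∀ {t r} → t * t * t ≈ κ → CubeSum deflated r → CubeSum A (suc r)
    cubeSum-deflated {t} {r} t³≈κ (u , expansion) = (t • w ∷ u) , λ x y z → begin
      (x ∗ y) ∙ z
        ≈⟨ solve 2 (λ p q → p := q :+ (p :+ (:- q))) refl _ (κ * (x ∙ w) * (y ∙ w) * (w ∙ z)) ⟩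
      κ * (x ∙ w) * (y ∙ w) * (w ∙ z) + ((x ∗ y) ∙ z - κ * (x ∙ w) * (y ∙ w) * (w ∙ z))
        ≈⟨ +-cong (first x y z) (trans (+-congˡ (solve 2 (λ p q → :- (p :* q) := (:- p) :* q)
          refl (κ * (x ∙ w) * (y ∙ w)) (w ∙ z)))
             (trans (sym (∗′-∙ x y z)) (expansion x y z))) ⟩
      (t • w) ∙ x * ((t • w) ∙ y) * ((t • w) ∙ z) + (∑[ l < r ] (u l ∙ x * (u l ∙ y) * (u l ∙ z))) ∎
      where
      first : ∀ x y z → κ * (x ∙ w) * (y ∙ w) * (w ∙ z) ≈ (t • w) ∙ x * ((t • w) ∙ y) * ((t • w) ∙ z)
      first x y z = begin
        κ * (x ∙ w) * (y ∙ w) * (w ∙ z)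
          ≈⟨ *-congʳ (*-cong (*-cong (sym t³≈κ) (∙-comm x w)) (∙-comm y w)) ⟩
        t * t * t * (w ∙ x) * (w ∙ y) * (w ∙ z)
          ≈⟨ solve 4 (λ t a b c → t :* t :* t :* a :* b :* c
            := t :* a :* (t :* b) :* (t :* c)) refl t (w ∙ x) (w ∙ y) (w ∙ z) ⟩
        t * (w ∙ x) * (t * (w ∙ y)) * (t * (w ∙ z))
          ≈⟨ *-cong (*-cong (•-∙ t w x) (•-∙ t w y)) (•-∙ t w z) ⟨
        (t • w) ∙ x * ((t • w) ∙ y) * ((t • w) ∙ z) ∎

  -- A family too large for the deflated `c` would yield one too large for `raised c`, so the bound
  -- descends with `r`. In rank 0 a single nonzero product already violates it.
  decompose : ∀ r (A : SlicesAlgebra n) → (∀ c →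
    ¬ IndependentImages (SlicesAlgebra._∗_ A c) (suc r)) → CubeSum A r
  decompose {n} r A rank≤r = case r rank≤r em
    where
    open SlicesAlgebra A
    open CommonEigenvector A

    case : ∀ r → (∀ c → ¬ IndependentImages (c ∗_) (suc r)) → Dec (∃ Nonzero) → CubeSum A r
    -- The algebra may be exhausted before `r` terms are spent; zero vectors fill the rest.
    case r rank≤r (no zeros) = cubeSum-zero A (λ x → [ (λ x≢0 →
      contradiction (x , x≢0) zeros) , (λ x≋0 → x≋0) ]′ (nonzero? x)) r
    case zero rank≤0 (yes (x , z , i , xzᵢ≉0)) = contradiction ((λ _ → z) , λ where
      c relation zero → x*y≈0⇒y≈0 xzᵢ≉0 (trans (*-comm _ _) (trans
        (sym (+-identityʳ _)) (relation i)))) (rank≤0 x)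
    case (suc r) rank≤r (yes (x , x-nonzero)) =
      let w , w≢0 , κ , κ≉0 , w-common = commonEigenvector x-nonzero
          t , t³≈κ = cubeRoot κ
          open Deflation A w≢0 κ≉0 w-common
      in cubeSum-deflated A w≢0 κ≉0 w-common t³≈κ
           (decompose r deflated (λ c → rank≤r (raised c) ∘ independentImages-raised))

open import Data.Nat.Base using (_+_)

-- Decompositions of tensors with commuting slices.

module TensorRank (em : ExcludedMiddle 0ℓ) (ℝ : CompleteOrderedField) where
  open CompleteOrderedField ℝ renaming (_+_ to infixl 6 _⊞_) hiding (zero)
  open Tensors ℝ
  open IntegerCoefficientSolver commutativeRing
  open LinearAlgebra em ℝ
  open Spectral em ℝ
  open Algebras em ℝ
  open Decomposition em ℝ
  open import Relation.Binary.Reasoning.Setoid setoid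
  private variable
    m n r : ℕ

  ∑-*-comm : (x : V m) (y : V n) (C : Fin m → Fin n → Carrier) →
             ∑[ k < m ] (x k * ∑[ l < n ] (y l * C k l)) ≈ ∑[ l < n ] (y l * ∑[ k < m ] (x k * C k l))
  ∑-*-comm {m} {n} x y C = begin
    (∑[ k < m ] (x k * ∑[ l < n ] (y l * C k l)))
      ≈⟨ sum-cong-≋ (λ k → *-distribˡ-sum {n} (x k) _) ⟩
    (∑[ k < m ] ∑[ l < n ] (x k * (y l * C k l)))
      ≈⟨ ∑-comm (λ k l → x k * (y l * C k l)) ⟩
    (∑[ l < n ] ∑[ k < m ] (x k * (y l * C k l)))
      ≈⟨ sum-cong-≋ (λ l → trans
           (sum-cong-≋ λ k → solve 3 (λ x y c → x :* (y :* c) := y :* (x :* c))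
             refl (x k) (y l) (C k l))
           (sym (*-distribˡ-sum {m} (y l) _))) ⟩
    (∑[ l < n ] (y l * ∑[ k < m ] (x k * C k l))) ∎

  unit-∙ : (i : Fin n) (x : V n) → unit i ∙ x ≈ x i
  -- The scalars `x k` are read as vectors over the index type `Fin 1`.
  unit-∙ i x = lincomb-unitˡ i (λ k (_ : Fin 1) → x k) zero

  module _ {S : Tensor n} (S-symmetric : IsSymmetric S)
           (S-commute : ∀ k l → Commute (slice S k) (slice S l)) where

    symmetric₁₂ : ∀ i j k → S j i k ≈ S i j k
    symmetric₁₂ i j k = S-symmetric (transpose 0F 1F) (i ∷ j ∷ k ∷ [])

    symmetric₂₃ : ∀ i j k → S i k j ≈ S i j k
    symmetric₂₃ i j k = S-symmetric (transpose 1F 2F) (i ∷ j ∷ k ∷ [])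

    sliceComb : V n → Matrix n
    sliceComb x i j = ∑[ k < n ] (x k * S i j k)

    infixl 8 _⋆_
    -- The product of the matrix `sliceComb x` and the vector `y`, in the very form in which
    -- `Rank≤⇒dependent` speaks of the images of a matrix.
    _⋆_ : V n → V n → V n
    x ⋆ y = lincomb y (column (sliceComb x))

    -- Bilinear expansion of an entry of `sliceComb x · sliceComb y`; it reduces commutation of
    -- combinations to that of the slices.
    sliceComb-sliceComb : ∀ x y l i → lincomb (column (sliceComb y) l) (column (sliceComb x)) i ≈
      ∑[ k < n ] (x k * ∑[ m < n ] (y m * (slice S k · slice S m) i l))
    sliceComb-sliceComb x y l i = trans (∙-lincomb (column (sliceComb y) l) x (λ k j → S i j k))
      (sum-cong-≋ λ k → *-congˡ {x k} (trans (∙-comm (column (sliceComb y) l) (λ j → S i j k))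
        (∙-lincomb (λ j → S i j k) y (λ m j → S j l m))))

    ⋆-commute : ∀ x y z → x ⋆ (y ⋆ z) ≋ y ⋆ (x ⋆ z)
    ⋆-commute x y z i = begin
      (x ⋆ (y ⋆ z)) i
        ≈⟨ lincomb-lincomb z (column (sliceComb y)) (column (sliceComb x)) i ⟨
      lincomb z (λ l → lincomb (column (sliceComb y) l) (column (sliceComb x))) i
        ≈⟨ sum-cong-≋ (λ l → *-congˡ {z l} (matrices l)) ⟩
      lincomb z (λ l → lincomb (column (sliceComb x) l) (column (sliceComb y))) i
        ≈⟨ lincomb-lincomb z (column (sliceComb x)) (column (sliceComb y)) i ⟩
      (y ⋆ (x ⋆ z)) i ∎
      where
      matrices : ∀ l → lincomb (column (sliceComb y) l) (column (sliceComb x)) i ≈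
                       lincomb (column (sliceComb x) l) (column (sliceComb y)) i
      matrices l = begin
        lincomb (column (sliceComb y) l) (column (sliceComb x)) i
          ≈⟨ sliceComb-sliceComb x y l i ⟩
        (∑[ k < n ] (x k * ∑[ m < n ] (y m * (slice S k · slice S m) i l)))
          ≈⟨ ∑-*-comm x y (λ k m → (slice S k · slice S m) i l) ⟩
        (∑[ m < n ] (y m * ∑[ k < n ] (x k * (slice S k · slice S m) i l)))
          ≈⟨ sum-cong-≋ (λ m → *-congˡ {y m} (sum-cong-≋ λ k → *-congˡ {x k} (S-commute k m i l))) ⟩
        (∑[ m < n ] (y m * ∑[ k < n ] (x k * (slice S m · slice S k) i l)))
          ≈⟨ sliceComb-sliceComb y x l i ⟨
        lincomb (column (sliceComb x) l) (column (sliceComb y)) i ∎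

    slicesAlgebra : SlicesAlgebra n
    slicesAlgebra = record
      { _∗_           = _⋆_
      ; ∗-linear      = λ x → record
        { cong        = λ y≋z → lincomb-cong y≋z (λ _ _ → refl)
        ; additive    = λ y z → lincomb-⊕ y z (column (sliceComb x))
        ; homogeneous = λ a y → lincomb-• a y (column (sliceComb x))
        }
      ; ∗-comm        = λ x y i → trans (∑-*-comm y x (S i))
          (sum-cong-≋ λ k → *-congˡ {x k} (sum-cong-≋ λ j → *-congˡ {y j} (symmetric₂₃ i k j)))
      ; ∗-selfAdjoint = λ x y z → trans (∙-comm (x ⋆ y) z)
          (trans (∙-lincomb z y (column (sliceComb x)))
            (sum-cong-≋ λ j → *-congˡ {y j} (sum-cong-≋ λ i → *-congˡ {z i} (sum-cong-≋ λ k →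
              *-congˡ {x k} (symmetric₁₂ j i k)))))
      ; ∗-commute     = ⋆-commute
      }

    ⋆-unit : ∀ i j k → unit i ∙ (unit k ⋆ unit j) ≈ S i j k
    ⋆-unit i j k = trans (unit-∙ i (unit k ⋆ unit j))
      (trans (lincomb-unitˡ j (column (sliceComb (unit k))) i) (lincomb-unitˡ k (λ k (_ : Fin 1) →
        S i j k) zero))

    commuting⇒SumOfCubes : (∀ M → M ∈SliceSpan S → Rank≤ M r) → SumOfCubes S r
    commuting⇒SumOfCubes {r} rank≤r = u , λ i j k → begin
      S i j k
        ≈⟨ ⋆-unit i j k ⟨
      unit i ∙ (unit k ⋆ unit j)
        ≈⟨ ∙-comm (unit i) _ ⟩
      (unit k ⋆ unit j) ∙ unit i
        ≈⟨ expansion (unit k) (unit j) (unit i) ⟩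
      (∑[ l < r ] (u l ∙ unit k * (u l ∙ unit j) * (u l ∙ unit i)))
        ≈⟨ sum-cong-≋ (λ l → trans (*-cong (*-cong (component l k) (component l j)) (component l i))
             (solve 3 (λ a b c → a :* b :* c := c :* b :* a) refl (u l k) (u l j) (u l i))) ⟩
      (∑[ l < r ] cube (u l) i j k) ∎
      where
      cubeSum = decompose r slicesAlgebra λ c →
        Rank≤⇒dependent (sliceComb c) (rank≤r (sliceComb c) (c , λ _ → refl))

      u : Vector (V n) r
      u = proj₁ cubeSum

      expansion = proj₂ cubeSum

      component : ∀ l i → u l ∙ unit i ≈ u l i
      component l i = trans (∙-comm (u l) (unit i)) (unit-∙ i (u l))

  SumOfCubes⇒Srank≤ : {T : Tensor n} → SumOfCubes T r → Srank≤ T r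
  SumOfCubes⇒Srank≤ {r = r} {T} cubes =
    let m , m-cubes , m-least = least (SumOfCubes T) r cubes in m , (m-cubes , m-least) , m-least r cubes

  SumOfCubes-suc : {T : Tensor n} → SumOfCubes T r → SumOfCubes T (suc r)
  SumOfCubes-suc (u , T≈) = (0v ∷ u) , λ i j k →
    trans (T≈ i j k) (sym (trans (+-congʳ (zeroʳ _)) (+-identityˡ _)))

  SumOfCubes-mono : {T : Tensor n} → m ℕ.≤′ r → SumOfCubes T m → SumOfCubes T r
  SumOfCubes-mono ℕ.≤′-refl         cubes = cubes
  SumOfCubes-mono (ℕ.≤′-step m≤′r) cubes = SumOfCubes-suc (SumOfCubes-mono m≤′r cubes)

  -- Commuting extensions from orthogonal vectors.

  module _ (u : Vector (V n) r) where

    sumOfCubes : Tensor n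
    sumOfCubes i j k = ∑[ l < r ] cube (u l) i j k

    sumOfCubes-symmetric : IsSymmetric sumOfCubes
    sumOfCubes-symmetric π i = sum-cong-≋ λ l → cube-symmetric (u l)
      where
      open import Algebra.Properties.CommutativeMonoid.Sum *-commutativeMonoid
        using () renaming (sum to product; sum-permute to product-permute)

      -- As a product over `Fin 3`, the entry inherits invariance under all permutations from finite
      -- products.
      cube≈product : ∀ (x : V n) (i : Vector (Fin n) 3) → cube x (i 0F) (i 1F) (i 2F) ≈ product (x ∘ i)
      cube≈product x i = trans (*-assoc _ _ _) (*-congˡ (*-congˡ (sym (*-identityʳ _))))

      cube-symmetric : ∀ x →
        cube x (i (π ⟨$⟩ʳ 0F)) (i (π ⟨$⟩ʳ 1F)) (i (π ⟨$⟩ʳ 2F)) ≈ cube x (i 0F) (i 1F) (i 2F)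
      cube-symmetric x = trans (cube≈product x (i ∘ (π ⟨$⟩ʳ_)))
        (trans (sym (product-permute (x ∘ i) π)) (sym (cube≈product x i)))

    -- The combination with coefficients `c` is the sum of the matrices `(c ∙ u l) u l ⊗ u l`, so
    -- its columns lie in the span of the `r` vectors.
    sumOfCubes-Rank≤ : ∀ M → M ∈SliceSpan sumOfCubes → Rank≤ M r
    sumOfCubes-Rank≤ M (c , M≈) = spanned⇒Rank≤ M u λ j → (λ l → u l j * (c ∙ u l)) , λ i → begin
      M i j
        ≈⟨ M≈ (i , j) ⟩
      (∑[ k < n ] (c k * ∑[ l < r ] (u l i * u l j * u l k)))
        ≈⟨ ∑-*-comm c (λ l → u l i * u l j) (λ k l → u l k) ⟩
      (∑[ l < r ] (u l i * u l j * (c ∙ u l)))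
        ≈⟨ sum-cong-≋ (λ l → solve 3 (λ a b c → a :* b :* c := b :* c :* a)
          refl (u l i) (u l j) (c ∙ u l)) ⟩
      (∑[ l < r ] (u l j * (c ∙ u l) * u l i)) ∎

    module _ (orthogonal : ∀ {p q} → p ≢ q → u p ∙ u q ≈ 0#) where

      slice-product : ∀ k l i j → (slice sumOfCubes k · slice sumOfCubes l) i j ≈
        ∑[ q < r ] (u q j * u q l * ∑[ p < r ] (u p i * u p k * (u p ∙ u q)))
      slice-product k l i j = begin
        (slice sumOfCubes k · slice sumOfCubes l) i j
          ≈⟨ ∙-cong row col ⟩
        lincomb (λ p → u p i * u p k) u ∙ lincomb (λ q → u q j * u q l) u
          ≈⟨ ∙-lincomb _ (λ q → u q j * u q l) u ⟩
        (∑[ q < r ] (u q j * u q l * (lincomb (λ p → u p i * u p k) u ∙ u q)))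
          ≈⟨ sum-cong-≋ (λ q → *-congˡ
            (trans (∙-comm (lincomb (λ p → u p i * u p k) u) (u q))
            (trans (∙-lincomb (u q) (λ p → u p i * u p k) u)
               (sum-cong-≋ λ p → *-congˡ {u p i * u p k} (∙-comm (u q) (u p)))))) ⟩
        (∑[ q < r ] (u q j * u q l * ∑[ p < r ] (u p i * u p k * (u p ∙ u q)))) ∎
        where
        row : ∀ m → slice sumOfCubes k i m ≈ lincomb (λ p → u p i * u p k) u m
        row m = sum-cong-≋ λ p → solve 3 (λ a b c → a :* b :* c := a :* c :* b)
          refl (u p i) (u p m) (u p k)

        col : ∀ m → slice sumOfCubes l m j ≈ lincomb (λ q → u q j * u q l) u m
        col m = sum-cong-≋ λ q → solve 3 (λ a b c → a :* b :* c := b :* c :* a)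
          refl (u q m) (u q j) (u q l)

      -- Orthogonality leaves only the terms with `p` equal to `q`, and these contain `k` and `l`
      -- through the symmetric factor `u p k * u p l`.
      sumOfCubes-commute : ∀ k l → Commute (slice sumOfCubes k) (slice sumOfCubes l)
      sumOfCubes-commute k l i j = trans (slice-product k l i j) (trans
        (sum-cong-≋ λ q → trans (*-distribˡ-sum {r} _ _) (trans
          (sum-cong-≋ λ p → exchange p q)
          (sym (*-distribˡ-sum {r} _ _))))
        (sym (slice-product l k i j)))
        where
        exchange : ∀ p q → u q j * u q l * (u p i * u p k * (u p ∙ u q)) ≈ u q j * u q k * (u p i * u p l * (u p ∙ u q))
        exchange p q with p Fin.≟ q
        ... | yes ≡.refl = solve 5 (λ j l i k g → j :* l :* (i :* k :* g)
          := j :* k :* (i :* l :* g)) refl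
              (u p j) (u p l) (u p i) (u p k) (u p ∙ u p)
        ... | no p≢q = trans (vanish (u q j * u q l) (u p i * u p k))
          (sym (vanish (u q j * u q k) (u p i * u p l)))
          where
          vanish : ∀ a b → a * (b * (u p ∙ u q)) ≈ 0#
          vanish a b = trans (*-congˡ (trans (*-congˡ (orthogonal p≢q)) (zeroʳ b))) (zeroʳ a)

  -- The first vector is a unit vector, which fixes the first coordinates of
  -- the others; the lengths are free, so no square roots are needed.
  withProducts : ∀ r → (Fin r → Fin r → Carrier) → Vector (V r) r
  withProducts (suc r) A zero    = unit zero
  withProducts (suc r) A (suc l) = - A zero (suc l) ∷
    withProducts r (λ l m → A (suc l) (suc m) ⊞ A zero (suc l) * A zero (suc m)) l

  -- Away from index 0 the first coordinates contribute `A zero (suc l) * A zero (suc m)`; adding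
  -- this product to the matrix in the recursive call cancels it.
  withProducts-∙ : ∀ r A → (∀ l m → A l m ≈ A m l) → ∀ {l m} → l ≢ m →
                   withProducts r A l ∙ withProducts r A m ≈ - A l m
  withProducts-∙ (suc r) A A-symmetric {zero}  {zero}  0≢0 = contradiction ≡.refl 0≢0
  withProducts-∙ (suc r) A A-symmetric {zero}  {suc m} _   = unit-∙ zero (withProducts (suc r) A (suc m))
  withProducts-∙ (suc r) A A-symmetric {suc l} {zero}  _   = trans
    (∙-comm (withProducts (suc r) A (suc l)) (unit zero))
    (trans (unit-∙ zero (withProducts (suc r) A (suc l))) (-‿cong (A-symmetric zero (suc l))))
  withProducts-∙ (suc r) A A-symmetric {suc l} {suc m} l≢m = trans
    (+-congˡ (withProducts-∙ r _ (λ l m →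
      +-cong (A-symmetric (suc l) (suc m)) (*-comm _ _)) (l≢m ∘ ≡.cong suc)))
    (solve 3 (λ a b c → (:- a) :* (:- b) :+ (:- (c :+ a :* b)) := :- c)
      refl (A zero (suc l)) (A zero (suc m)) (A (suc l) (suc m)))

  ∑-+ : ∀ n {r} (x : V (n + r)) → sum x ≈ (∑[ i < n ] x (i ↑ˡ r)) ⊞ (∑[ i < r ] x (n ↑ʳ i))
  ∑-+ zero    x = sym (+-identityˡ _)
  ∑-+ (suc n) x = trans (+-congˡ (∑-+ n (x ∘ suc))) (sym (+-assoc _ _ _))

  ++-∙ : (x x′ : V n) (y y′ : V r) → (x ++ y) ∙ (x′ ++ y′) ≈ x ∙ x′ ⊞ y ∙ y′
  ++-∙ {n} x x′ y y′ = trans (∑-+ n (λ i → (x ++ y) i * (x′ ++ y′) i)) (+-cong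
    (sum-cong-≋ λ i → reflexive (≡.cong₂ _*_ (lookup-++ˡ x y i) (lookup-++ˡ x′ y′ i)))
    (sum-cong-≋ λ i → reflexive (≡.cong₂ _*_ (lookup-++ʳ x y i) (lookup-++ʳ x′ y′ i))))

  module _ (u : Vector (V n) r) where

    orthogonalExtension : Vector (V (n + r)) r
    orthogonalExtension l = u l ++ withProducts r (λ l m → u l ∙ u m) l

    orthogonalExtension-orthogonal : ∀ {p q} → p ≢ q →
      orthogonalExtension p ∙ orthogonalExtension q ≈ 0#
    orthogonalExtension-orthogonal {p} {q} p≢q = begin
      orthogonalExtension p ∙ orthogonalExtension q
        ≈⟨ ++-∙ (u p) (u q) _ _ ⟩
      u p ∙ u q ⊞ withProducts r (λ l m → u l ∙ u m) p ∙ withProducts r (λ l m → u l ∙ u m) q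
        ≈⟨ +-congˡ (withProducts-∙ r (λ l m → u l ∙ u m) (λ l m → ∙-comm (u l) (u m)) p≢q) ⟩
      u p ∙ u q - u p ∙ u q
        ≈⟨ -‿inverseʳ _ ⟩
      0# ∎

    orthogonalExtension-subtensor : {T : Tensor n} → (∀ i j k → T i j k ≈ sumOfCubes u i j k) →
                                    IsSubtensor {n} {r} T (sumOfCubes orthogonalExtension)
    orthogonalExtension-subtensor T≈ i j k = trans (T≈ i j k) (sum-cong-≋ λ l →
      *-cong (*-cong (restrict l i) (restrict l j)) (restrict l k))
      where
      restrict : ∀ l i → u l i ≈ orthogonalExtension l (i ↑ˡ r)
      restrict l i = reflexive (≡.sym (lookup-++ˡ (u l) _ i))

  CommutingExtension : Tensor n → ℕ → Set
  CommutingExtension {n} T r =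
    Σ[ S ∈ Tensor (n + r) ]
      (IsSymmetric S
      × (∀ k l → Commute (slice S k) (slice S l))
      × IsSubtensor {n} {r} T S
      × (∀ M → M ∈SliceSpan S → Rank≤ M r))

  Srank≤⇔CommutingExtension : (T : Tensor n) → ∀ r → Srank≤ T r ⇔ CommutingExtension T r
  Srank≤⇔CommutingExtension {n} T r = mk⇔ extend restrict
    where
    extend : Srank≤ T r → CommutingExtension T r
    extend (m , (cubes , _) , m≤r) =
      -- Padding to exactly `r` vectors makes the extension add exactly `r` coordinates.
      let u , T≈ = SumOfCubes-mono (ℕ.≤⇒≤′ m≤r) cubes
          û = orthogonalExtension u
      in sumOfCubes û , sumOfCubes-symmetric û ,
         sumOfCubes-commute û (orthogonalExtension-orthogonal u) ,
         orthogonalExtension-subtensor u T≈ , sumOfCubes-Rank≤ û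

    restrict : CommutingExtension T r → Srank≤ T r
    restrict (S , S-symmetric , S-commute , T⊂S , rank≤r) =
      let u , S≈ = commuting⇒SumOfCubes S-symmetric S-commute rank≤r
      in SumOfCubes⇒Srank≤ ((λ l i → u l (i ↑ˡ r)) , λ i j k →
        trans (T⊂S i j k) (S≈ (i ↑ˡ r) (j ↑ˡ r) (k ↑ˡ r)))

theorem3 :
    ExcludedMiddle 0ℓ →
    (ℝ : CompleteOrderedField) → let open Tensors ℝ in
    (n : ℕ) (T : Tensor n) → IsSymmetric T →
    (r : ℕ) →
    Srank≤ T r ⇔
    (Σ[ S ∈ Tensor (n + r) ]
      (IsSymmetric S
      × (∀ k l → Commute (slice S k) (slice S l))
      × IsSubtensor {n} {r} T S
      × (∀ M → M ∈SliceSpan S → Rank≤ M r)))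
theorem3 em ℝ n T _ r = TensorRank.Srank≤⇔CommutingExtension em ℝ T r
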